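{- Let $\Sigma$ be a signature of contractive operators with theory $\mathcal{O}_\Sigma$ and associated endofunctor $\tilde\Sigma$ on $\mathbf{CMet}$, and let $\mathcal{U}$ be a continuous quantitative equational theory (of a type disjoint from $\Sigma$). Then $\mu y.\,\mathbb{C}T_{\mathcal{U}}(\tilde\Sigma y+-)$, with its canonical monad structure, is the free monad on the theory $\mathcal{U}+\mathcal{O}_\Sigma$ on $\mathbf{CMet}$; i.e. it is isomorphic as a monad to $\mathbb{C}T_{\mathcal{U}+\mathcal{O}_\Sigma}$.
   Context: An extended metric space is a set $X$ with $d_X:X\times X\to[0,\infty]$ satisfying $d_X(x,y)=0$ iff $x=y$, symmetry and the triangle inequality. $\mathbf{Met}$ is the category of extended metric spaces and non-expansive maps; $\mathbf{CMet}$ is its full subcategory of (Cauchy) complete spaces. Quantitative theories. A signature $\Sigma$ is a set of function symbols $f:n$ of finite arity $n\in\mathbb{N}$. Fix a countably infinite set of variables $V$; terms are $\Sigma$-terms over $V$. A quantitative equation is an expression $t=_\varepsilon s$ with $t,s$ terms and $\varepsilon\in\mathbb{Q}_{\ge0}$. A conditional quantitative equation is $\Gamma\vdash t=_\varepsilon s$ with $\Gamma$ a finite set of quantitative equations. A quantitative equational theory of type $\Sigma$ is a set $\mathcal{U}$ of conditional quantitative equations containing (for all variables and rationals $\varepsilon,\varepsilon'\ge 0$) $\vdash x=_0x$; $\{x=_\varepsilon y\}\vdash y=_\varepsilon x$; $\{x=_\varepsilon z,z=_{\varepsilon'}y\}\vdash x=_{\varepsilon+\varepsilon'}y$; $\{x=_\varepsilon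 y\}\vdash x=_{\varepsilon+\varepsilon'}y$ for $\varepsilon'>0$; $\{x_i=_\varepsilon y_i\mid i=1,\dots,n\}\vdash f(x_1,\dots,x_n)=_\varepsilon f(y_1,\dots,y_n)$ for $f:n\in\Sigma$; and closed under: continuity (if $\Gamma\vdash t=_{\varepsilon'}s\in\mathcal{U}$ for all $\varepsilon'>\varepsilon$ then $\Gamma\vdash t=_\varepsilon s\in\mathcal{U}$), substitution of terms for variables, assumption ($\Gamma\vdash\phi\in\mathcal{U}$ whenever $\phi\in\Gamma$), and cut (if $\Gamma\vdash\phi\in\mathcal{U}$ for all $\phi\in\Theta$ and $\Theta\vdash\psi\in\mathcal{U}$ then $\Gamma\vdash\psi\in\mathcal{U}$). A set $A$ of conditional quantitative equations axiomatizes $\mathcal{U}$ if $\mathcal{U}$ is the smallest theory containing $A$. $\mathcal{U}$ is continuous if it is axiomatized by a collection of continuous schemata, i.e. sets consisting of all $\{x_i=_{\varepsilon_i}y_i\mid i=1,\dots,n\}\vdash t=_\varepsilon s$ with $\varepsilon_i,\varepsilon\in\mathbb{Q}_{\ge0}$ and $\varepsilon\ge f(\varepsilon_1,\dots,\varepsilon_n)$, where $x_i,y_i$ are fixed variables, $t,s$ fixed terms and $f:\mathbb{R}_{\ge0}^n\to\mathbb{R}_{\ge0}$ is a fixed continuous function. Models. A quantitative $\Sigma$-algebra is an extended metric space $A$ with, for each $f:n\in\Sigma$, a map $f^A:A^n\to A$ that is non-expansive for the max metric on $A^n$. It satisfies $\Gamma\vdash t=_\varepsilon s$ if for every assignment $\iota:V\to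 A$ (extended homomorphically to terms), $d_A(\iota(t'),\iota(s'))\le\varepsilon'$ for all $t'=_{\varepsilon'}s'\in\Gamma$ implies $d_A(\iota(t),\iota(s))\le\varepsilon$. $\mathbb{C}\mathbb{K}(\Sigma,\mathcal{U})$ is the category of quantitative $\Sigma$-algebras with complete carrier satisfying all members of $\mathcal{U}$, with non-expansive $\Sigma$-homomorphisms. For $\mathcal{U}$ continuous, the forgetful functor $\mathbb{C}\mathbb{K}(\Sigma,\mathcal{U})\to\mathbf{CMet}$ has a left adjoint (known), sending $X$ to the Cauchy completion of the free quantitative algebra on $X$ satisfying $\mathcal{U}$; the induced monad on $\mathbf{CMet}$ is denoted $\mathbb{C}T_{\mathcal{U}}$ and called the free monad on $\mathcal{U}$ on $\mathbf{CMet}$. Sum. For theories of disjoint types $\Sigma,\Sigma'$, $\mathcal{U}+\mathcal{U}'$ is the smallest quantitative equational theory of type $\Sigma\cup\Sigma'$ containing $\mathcal{U}$ and $\mathcal{U}'$ (continuous when both are). Contractive operators. A signature of contractive operators $\Sigma$ is an at most countable collection of function symbols $f$, each with an arity $n\in\mathbb{N}$ and a contractive factor $0<c<1$, written $f:\langle n,c\rangle\in\Sigma$. $\mathcal{O}_\Sigma$ is axiomatized by, for each $f:\langle n,c\rangle\in\Sigma$: $\{x_1=_\varepsilon y_1,\dots,x_n=_\varepsilon y_n\}\vdash f(x_1,\dots,x_n)=_\delta f(y_1,\dots,y_n)$ for all $\varepsilon,\delta\in\mathbb{Q}_{\ge0}$ with $\delta\ge c\varepsilon$; it is continuous. The endofunctor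 on $\mathbf{CMet}$ is $\tilde\Sigma X=\coprod_{f:\langle n,c\rangle\in\Sigma}c\cdot X^n$, where $X^n$ carries the max metric, $c\cdot(Y,d_Y)=(Y,c\,d_Y)$ (with $c\cdot\infty=\infty$), and coproducts are disjoint unions with distance $\infty$ between components. Resumptions. $\mu y.Hy$ denotes (the carrier of) the initial algebra of an endofunctor $H$. For a monad $(T,\eta,\mu)$ and an endofunctor $F$, write $RX=\mu y.T(Fy+X)$ with structure isomorphism $\alpha_X:T(FRX+X)\to RX$. $RX$ carries an Eilenberg–Moore $T$-algebra structure $\alpha_X\circ\mu\circ T\alpha_X^{ -1}$ and an $F$-algebra structure $\alpha_X\circ\eta\circ\mathrm{in}_l:FRX\to RX$. The canonical monad structure on $R$ has unit $\alpha_X\circ\eta\circ\mathrm{in}_r:X\to RX$ and multiplication the unique map $RRX\to RX$ that is a homomorphism for both the $T$- and the $F$-algebra structures and restricts to the identity along the unit $RX\to RRX$. -}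

module Defs where

open import Level using (Level; 0ℓ; _⊔_) renaming (suc to lsuc)
open import Data.Bool.Base using (Bool; true; false; if_then_else_)
open import Data.Empty using (⊥-elim)
open import Data.Fin.Base using (Fin; zero; suc)
import Data.Integer.Base as ℤ
import Data.Integer.Properties as ℤ
open import Data.List.Base using (List; []; _∷_; map; tabulate)
open import Data.List.Relation.Unary.Any using (here; there)
open import Data.List.Membership.Propositional using (_∈_)
open import Data.List.Membership.Propositional.Properties using (∈-map⁺; ∈-map⁻; ∈-tabulate⁺; ∈-tabulate⁻)
open import Data.Nat.Base as ℕ using (ℕ; zero; suc)
import Data.Nat.Properties as ℕ
open import Data.Nat.Coprimality using (1-coprimeTo)
open import Data.Product.Base using (Σ; Σ-syntax; ∃; ∃-syntax; ∃₂; _×_; _,_; proj₁; proj₂)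
open import Data.Rational.Base as ℚ using (ℚ; mkℚ; 0ℚ; 1ℚ; ½)
import Data.Rational.Properties as ℚ
open import Data.Rational.Solver using (module +-*-Solver)
open import Data.Sum.Base using (_⊎_; inj₁; inj₂; [_,_]′)
open import Function.Bundles using (_⇔_; mk⇔; _↣_; module Equivalence)
open import Relation.Binary.Bundles using (Setoid)
open import Relation.Binary.Definitions using (tri<; tri≈; tri>)
open import Relation.Binary.Structures using (IsEquivalence)
open import Relation.Binary.PropositionalEquality using (_≡_; refl; sym; trans; cong; subst; subst₂)
open import Relation.Nullary using (¬_)

record ℚ≥0 : Set where
  constructor mk
  field
    val    : ℚ
    nonNeg : 0ℚ ℚ.≤ val

open ℚ≥0 public

infixl 6 _+_
infixl 7 _*_
infix  4 _≤_ _<_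

0# 1# : ℚ≥0
0# = mk 0ℚ ℚ.≤-refl
1# = mk 1ℚ (ℚ.nonNegative⁻¹ 1ℚ)

opaque
  _+_ _*_ : ℚ≥0 → ℚ≥0 → ℚ≥0
  p + q = mk (val p ℚ.+ val q) (ℚ.+-mono-≤ (nonNeg p) (nonNeg q))
  p * q = mk (val p ℚ.* val q)
    (ℚ.nonNegative⁻¹ _ {{ℚ.nonNeg*nonNeg⇒nonNeg (val p) {{ℚ.nonNegative (nonNeg p)}} (val q) {{ℚ.nonNegative (nonNeg q)}}}})

record _≤_ (p q : ℚ≥0) : Set where
  constructor ≤⁺
  field ≤⁻ : val p ℚ.≤ val q

record _<_ (p q : ℚ≥0) : Set where
  constructor <⁺
  field <⁻ : val p ℚ.< val q

open _≤_ public
open _<_ public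

val≡ : ∀ {p q} → val p ≡ val q → p ≡ q
val≡ {mk _ a} {mk _ b} refl = cong (mk _) (ℚ.≤-irrelevant a b)

≤-refl : ∀ {p} → p ≤ p
≤-refl = ≤⁺ ℚ.≤-refl

≤-reflexive : ∀ {p q} → p ≡ q → p ≤ q
≤-reflexive refl = ≤-refl

≤-trans : ∀ {p q r} → p ≤ q → q ≤ r → p ≤ r
≤-trans (≤⁺ a) (≤⁺ b) = ≤⁺ (ℚ.≤-trans a b)

≤-total : ∀ p q → p ≤ q ⊎ q ≤ p
≤-total p q with ℚ.≤-total (val p) (val q)
... | inj₁ a = inj₁ (≤⁺ a)
... | inj₂ a = inj₂ (≤⁺ a)

<⇒≤ : ∀ {p q} → p < q → p ≤ q
<⇒≤ (<⁺ a) = ≤⁺ (ℚ.<⇒≤ a)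

≤-<-trans : ∀ {p q r} → p ≤ q → q < r → p < r
≤-<-trans (≤⁺ a) (<⁺ b) = <⁺ (ℚ.≤-<-trans a b)

<-≤-trans : ∀ {p q r} → p < q → q ≤ r → p < r
<-≤-trans (<⁺ a) (≤⁺ b) = <⁺ (ℚ.<-≤-trans a b)

<⇒≱ : ∀ {p q} → p < q → ¬ (q ≤ p)
<⇒≱ (<⁺ a) (≤⁺ b) = ℚ.<-irrefl refl (ℚ.<-≤-trans a b)

0≤ : ∀ {p} → 0# ≤ p
0≤ {p} = ≤⁺ (nonNeg p)

0<1 : 0# < 1#
0<1 = <⁺ (ℚ.positive⁻¹ 1ℚ)

opaque
  unfolding _+_ _*_

  +-mono-≤ : ∀ {p q r s} → p ≤ q → r ≤ s → p + r ≤ q + s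
  +-mono-≤ (≤⁺ a) (≤⁺ b) = ≤⁺ (ℚ.+-mono-≤ a b)

  *-mono-≤ : ∀ {p q r s} → p ≤ q → r ≤ s → p * r ≤ q * s
  *-mono-≤ {p} {q} {r} {s} (≤⁺ a) (≤⁺ b) = ≤⁺ (ℚ.≤-trans
    (ℚ.*-monoʳ-≤-nonNeg (val r) {{ℚ.nonNegative (nonNeg r)}} a)
    (ℚ.*-monoˡ-≤-nonNeg (val q) {{ℚ.nonNegative (nonNeg q)}} b))

  *-cancelˡ-≤ : ∀ r {p q} → 0# < r → r * p ≤ r * q → p ≤ q
  *-cancelˡ-≤ r (<⁺ a) (≤⁺ b) = ≤⁺ (ℚ.*-cancelˡ-≤-pos (val r) {{ℚ.positive a}} b)

  *-pos : ∀ {p q} → 0# < p → 0# < q → 0# < p * q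
  *-pos {p} {q} (<⁺ a) (<⁺ b) =
    <⁺ (ℚ.positive⁻¹ _ {{ℚ.pos*pos⇒pos (val p) {{ℚ.positive a}} (val q) {{ℚ.positive b}}}})

  +-comm : ∀ p q → p + q ≡ q + p
  +-comm p q = val≡ (ℚ.+-comm (val p) (val q))

  +-assoc : ∀ p q r → (p + q) + r ≡ p + (q + r)
  +-assoc p q r = val≡ (ℚ.+-assoc (val p) (val q) (val r))

  +-identityʳ : ∀ p → p + 0# ≡ p
  +-identityʳ p = val≡ (ℚ.+-identityʳ (val p))

  +-identityˡ : ∀ p → 0# + p ≡ p
  +-identityˡ p = val≡ (ℚ.+-identityˡ (val p))

  +-interchange : ∀ p q r s → (p + q) + (r + s) ≡ (p + r) + (q + s)
  +-interchange p q r s = val≡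
    (solve 4 (λ p q r s → (p :+ q) :+ (r :+ s) := (p :+ r) :+ (q :+ s)) refl (val p) (val q) (val r) (val s))
    where open +-*-Solver

  +-regroup : ∀ r l → l + (r + (l + l) + l) ≡ r + (l + l + (l + l))
  +-regroup r l = val≡
    (solve 2 (λ r l → l :+ (r :+ (l :+ l) :+ l) := r :+ (l :+ l :+ (l :+ l))) refl (val r) (val l))
    where open +-*-Solver

  *-distribˡ-+ : ∀ p q r → p * (q + r) ≡ p * q + p * r
  *-distribˡ-+ p q r = val≡ (ℚ.*-distribˡ-+ (val p) (val q) (val r))

  *-identityˡ : ∀ p → 1# * p ≡ p
  *-identityˡ p = val≡ (ℚ.*-identityˡ (val p))

  *-zeroʳ : ∀ p → p * 0# ≡ 0#
  *-zeroʳ p = val≡ (ℚ.*-zeroʳ (val p))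

  p<p+q : ∀ {p q} → 0# < q → p < p + q
  p<p+q {p} {q} (<⁺ a) = <⁺ (subst (ℚ._< val p ℚ.+ val q) (ℚ.+-identityʳ (val p)) (ℚ.+-monoʳ-< (val p) a))

  <-gap : ∀ {p q} → p < q → ∃[ r ] (0# < r × p + r ≡ q)
  <-gap {p} {q} (<⁺ a) = mk (val q ℚ.- val p) (ℚ.<⇒≤ pos) , <⁺ pos , val≡ eq
    where
    open +-*-Solver
    pos : 0ℚ ℚ.< val q ℚ.- val p
    pos = subst (ℚ._< val q ℚ.- val p) (ℚ.+-inverseʳ (val p)) (ℚ.+-monoˡ-< (ℚ.- val p) a)
    eq : val p ℚ.+ (val q ℚ.- val p) ≡ val q
    eq = solve 2 (λ p q → p :+ (q :+ (:- p)) := q) refl (val p) (val q)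

  half : ∀ {r} → 0# < r → ∃[ h ] (0# < h × h + h ≡ r)
  half {r} (<⁺ a) = mk (½ ℚ.* val r) (ℚ.<⇒≤ pos) , <⁺ pos , val≡ eq
    where
    open +-*-Solver
    pos : 0ℚ ℚ.< ½ ℚ.* val r
    pos = subst (ℚ._< ½ ℚ.* val r) (ℚ.*-zeroʳ ½) (ℚ.*-monoʳ-<-pos ½ a)
    eq : ½ ℚ.* val r ℚ.+ ½ ℚ.* val r ≡ val r
    eq = trans (sym (ℚ.*-distribʳ-+ (val r) ½ ½)) (ℚ.*-identityˡ (val r))

p≤p+q : ∀ {p q} → p ≤ p + q
p≤p+q {p} {q} = ≤-trans (≤-reflexive (sym (+-identityʳ p))) (+-mono-≤ ≤-refl 0≤)

1/suc : ℕ → ℚ≥0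
1/suc k = mk (mkℚ (ℤ.+ 1) k (1-coprimeTo (suc k))) (ℚ.nonNegative⁻¹ _)

1/suc-anti : ∀ {k l} → k ℕ.≤ l → 1/suc l ≤ 1/suc k
1/suc-anti p = ≤⁺ (ℚ.*≤* (ℤ.*-monoˡ-≤-nonNeg (ℤ.+ 1) (ℤ.+≤+ (ℕ.s≤s p))))

1/suc-pos : ∀ k → 0# < 1/suc k
1/suc-pos k = <⁺ (ℚ.positive⁻¹ _)

archimedean : ∀ {p} → 0# < p → ∃[ k ] (1/suc k ≤ p)
archimedean {mk (mkℚ (ℤ.+ zero) _ _) _} (<⁺ (ℚ.*<* (ℤ.+<+ ())))
archimedean {mk (mkℚ (ℤ.+ suc n) k _) _} _ =
  k , ≤⁺ (ℚ.*≤* (ℤ.*-monoʳ-≤-nonNeg (ℤ.+ suc k) {ℤ.+ 1} {ℤ.+ suc n} (ℤ.+≤+ (ℕ.s≤s ℕ.z≤n))))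
archimedean {mk (mkℚ ℤ.-[1+ _ ] _ _) _} (<⁺ (ℚ.*<* ()))

record Category (o ℓ e : Level) : Set (lsuc (o ⊔ ℓ ⊔ e)) where
  infix  4 _≈_ _⇒_
  infixr 9 _∘_
  field
    Obj       : Set o
    _⇒_       : Obj → Obj → Set ℓ
    _≈_       : ∀ {A B} → A ⇒ B → A ⇒ B → Set e
    id        : ∀ {A} → A ⇒ A
    _∘_       : ∀ {A B C} → B ⇒ C → A ⇒ B → A ⇒ C
    equiv     : ∀ {A B} → IsEquivalence (_≈_ {A} {B})
    ∘-resp-≈  : ∀ {A B C} {f f′ : B ⇒ C} {g g′ : A ⇒ B} → f ≈ f′ → g ≈ g′ → f ∘ g ≈ f′ ∘ g′
    assoc     : ∀ {A B C D} {f : A ⇒ B} {g : B ⇒ C} {h : C ⇒ D} → (h ∘ g) ∘ f ≈ h ∘ (g ∘ f)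
    identityˡ : ∀ {A B} {f : A ⇒ B} → id ∘ f ≈ f
    identityʳ : ∀ {A B} {f : A ⇒ B} → f ∘ id ≈ f

  ≈-refl : ∀ {A B} {f : A ⇒ B} → f ≈ f
  ≈-refl = IsEquivalence.refl equiv

  ≈-sym : ∀ {A B} {f g : A ⇒ B} → f ≈ g → g ≈ f
  ≈-sym = IsEquivalence.sym equiv

  ≈-trans : ∀ {A B} {f g h : A ⇒ B} → f ≈ g → g ≈ h → f ≈ h
  ≈-trans = IsEquivalence.trans equiv

  infixr 2 _○_
  _○_ : ∀ {A B} {f g h : A ⇒ B} → f ≈ g → g ≈ h → f ≈ h
  _○_ = ≈-trans

  infixr 8 _⟩∘_ _∘⟨_
  _⟩∘_ : ∀ {A B C} {f f′ : B ⇒ C} → f ≈ f′ → (g : A ⇒ B) → f ∘ g ≈ f′ ∘ g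
  p ⟩∘ g = ∘-resp-≈ p ≈-refl

  _∘⟨_ : ∀ {A B C} (f : B ⇒ C) {g g′ : A ⇒ B} → g ≈ g′ → f ∘ g ≈ f ∘ g′
  f ∘⟨ p = ∘-resp-≈ ≈-refl p

record Functor {o ℓ e o′ ℓ′ e′} (C : Category o ℓ e) (D : Category o′ ℓ′ e′) :
               Set (o ⊔ ℓ ⊔ e ⊔ o′ ⊔ ℓ′ ⊔ e′) where
  private
    module C = Category C
    module D = Category D
  field
    F₀           : C.Obj → D.Obj
    F₁           : ∀ {A B} → A C.⇒ B → F₀ A D.⇒ F₀ B
    identity     : ∀ {A} → F₁ (C.id {A}) D.≈ D.id
    homomorphism : ∀ {A B E} {f : A C.⇒ B} {g : B C.⇒ E} → F₁ (g C.∘ f) D.≈ F₁ g D.∘ F₁ f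
    F-resp-≈     : ∀ {A B} {f g : A C.⇒ B} → f C.≈ g → F₁ f D.≈ F₁ g

record BinaryCoproducts {o ℓ e} (C : Category o ℓ e) : Set (o ⊔ ℓ ⊔ e) where
  open Category C
  infixr 6 _∐_
  field
    _∐_     : Obj → Obj → Obj
    inl     : ∀ {A B} → A ⇒ A ∐ B
    inr     : ∀ {A B} → B ⇒ A ∐ B
    [_,_]   : ∀ {A B D} → A ⇒ D → B ⇒ D → A ∐ B ⇒ D
    inject₁ : ∀ {A B D} {f : A ⇒ D} {g : B ⇒ D} → [ f , g ] ∘ inl ≈ f
    inject₂ : ∀ {A B D} {f : A ⇒ D} {g : B ⇒ D} → [ f , g ] ∘ inr ≈ g
    unique  : ∀ {A B D} {f : A ⇒ D} {g : B ⇒ D} {h : A ∐ B ⇒ D} →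
              h ∘ inl ≈ f → h ∘ inr ≈ g → [ f , g ] ≈ h

  _∐₁_ : ∀ {A A′ B B′} → A ⇒ A′ → B ⇒ B′ → A ∐ B ⇒ A′ ∐ B′
  f ∐₁ g = [ inl ∘ f , inr ∘ g ]

  ∐₁-id : ∀ {A B} → id {A} ∐₁ id {B} ≈ id
  ∐₁-id = unique (identityˡ ○ ≈-sym identityʳ) (identityˡ ○ ≈-sym identityʳ)

  ∐₁-∘ : ∀ {A A′ A″ B B′ B″} {f : A ⇒ A′} {f′ : A′ ⇒ A″} {g : B ⇒ B′} {g′ : B′ ⇒ B″} →
         (f′ ∘ f) ∐₁ (g′ ∘ g) ≈ (f′ ∐₁ g′) ∘ (f ∐₁ g)
  ∐₁-∘ = unique
    (assoc ○ _ ∘⟨ inject₁ ○ ≈-sym assoc ○ inject₁ ⟩∘ _ ○ assoc)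
    (assoc ○ _ ∘⟨ inject₂ ○ ≈-sym assoc ○ inject₂ ⟩∘ _ ○ assoc)

  ∐₁-resp-≈ : ∀ {A A′ B B′} {f f′ : A ⇒ A′} {g g′ : B ⇒ B′} → f ≈ f′ → g ≈ g′ → f ∐₁ g ≈ f′ ∐₁ g′
  ∐₁-resp-≈ p q = unique (inject₁ ○ _ ∘⟨ ≈-sym p) (inject₂ ○ _ ∘⟨ ≈-sym q)

record Monad {o ℓ e} (C : Category o ℓ e) : Set (o ⊔ ℓ ⊔ e) where
  open Category C
  field
    functor : Functor C C
  open Functor functor public renaming
    (F₀ to T₀; F₁ to T₁; identity to T-identity; homomorphism to T-homomorphism; F-resp-≈ to T-resp-≈)
  field
    η           : ∀ X → X ⇒ T₀ X
    μ           : ∀ X → T₀ (T₀ X) ⇒ T₀ X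
    η-natural   : ∀ {X Y} (f : X ⇒ Y) → η Y ∘ f ≈ T₁ f ∘ η X
    μ-natural   : ∀ {X Y} (f : X ⇒ Y) → μ Y ∘ T₁ (T₁ f) ≈ T₁ f ∘ μ X
    μ-assoc     : ∀ {X} → μ X ∘ T₁ (μ X) ≈ μ X ∘ μ (T₀ X)
    μ-identityˡ : ∀ {X} → μ X ∘ T₁ (η X) ≈ id
    μ-identityʳ : ∀ {X} → μ X ∘ η (T₀ X) ≈ id

record MonadIso {o ℓ e} {C : Category o ℓ e} (M N : Monad C) : Set (o ⊔ ℓ ⊔ e) where
  open Category C
  private
    module M = Monad M
    module N = Monad N
  field
    to      : ∀ X → M.T₀ X ⇒ N.T₀ X
    from    : ∀ X → N.T₀ X ⇒ M.T₀ X
    to∘from : ∀ X → to X ∘ from X ≈ id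
    from∘to : ∀ X → from X ∘ to X ≈ id
    natural : ∀ {X Y} (f : X ⇒ Y) → to Y ∘ M.T₁ f ≈ N.T₁ f ∘ to X
    to-η    : ∀ X → to X ∘ M.η X ≈ N.η X
    to-μ    : ∀ X → to X ∘ M.μ X ≈ N.μ X ∘ (N.T₁ (to X) ∘ to (M.T₀ X))

record LeftAdjoint {o ℓ e o′ ℓ′ e′} {C : Category o ℓ e} {D : Category o′ ℓ′ e′}
                   (U : Functor D C) : Set (o ⊔ ℓ ⊔ e ⊔ o′ ⊔ ℓ′ ⊔ e′) where
  private
    module C = Category C
    module D = Category D
  open Functor U renaming (F₀ to U₀; F₁ to U₁)
  field
    Free       : C.Obj → D.Obj
    unit       : ∀ X → X C.⇒ U₀ (Free X)
    extend     : ∀ {X B} → X C.⇒ U₀ B → Free X D.⇒ B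
    extend-∘   : ∀ {X B} (f : X C.⇒ U₀ B) → U₁ (extend f) C.∘ unit X C.≈ f
    extend-uniq : ∀ {X B} {f : X C.⇒ U₀ B} (h : Free X D.⇒ B) → U₁ h C.∘ unit X C.≈ f → h D.≈ extend f

module _ {o ℓ e o′ ℓ′ e′} {C : Category o ℓ e} {D : Category o′ ℓ′ e′}
         {U : Functor D C} (L : LeftAdjoint U) where
  private
    module C = Category C
    module D = Category D
  open Functor U renaming (F₀ to U₀; F₁ to U₁; identity to U-id; homomorphism to U-∘; F-resp-≈ to U-resp)
  open LeftAdjoint L

  private
    uniq₂ : ∀ {X B} (h k : Free X D.⇒ B) → U₁ h C.∘ unit X C.≈ U₁ k C.∘ unit X → h D.≈ k
    uniq₂ h k p = D.≈-trans (extend-uniq h p) (D.≈-sym (extend-uniq k C.≈-refl))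

    L₁ : ∀ {X Y} → X C.⇒ Y → Free X D.⇒ Free Y
    L₁ f = extend (unit _ C.∘ f)

    ε : ∀ B → Free (U₀ B) D.⇒ B
    ε B = extend C.id

    step : ∀ {X A B} {g : A D.⇒ B} {f : Free X D.⇒ A} {h} → U₁ f C.∘ unit X C.≈ h →
           U₁ (g D.∘ f) C.∘ unit X C.≈ U₁ g C.∘ h
    step p = C.≈-trans (U-∘ C.⟩∘ _) (C.≈-trans C.assoc (_ C.∘⟨ p))

    ε-natural : ∀ {A B} (g : A D.⇒ B) → ε B D.∘ L₁ (U₁ g) D.≈ g D.∘ ε A
    ε-natural g = uniq₂ _ _
      (step (extend-∘ _) C.○ C.≈-sym C.assoc C.○ extend-∘ _ C.⟩∘ _ C.○ C.identityˡ C.○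
       C.≈-sym (step (extend-∘ _) C.○ C.identityʳ))

    T : Functor C C
    T = record
      { F₀           = λ X → U₀ (Free X)
      ; F₁           = λ f → U₁ (L₁ f)
      ; identity     = C.≈-trans (U-resp (uniq₂ _ _ (extend-∘ _ C.○ C.identityʳ C.○
                         C.≈-sym (U-id C.⟩∘ _ C.○ C.identityˡ)))) U-id
      ; homomorphism = C.≈-trans (U-resp (uniq₂ _ _ (extend-∘ _ C.○ C.≈-sym
                         (step (extend-∘ _) C.○ C.≈-sym C.assoc C.○ extend-∘ _ C.⟩∘ _ C.○ C.assoc)))) U-∘
      ; F-resp-≈     = λ p → U-resp (uniq₂ _ _ (extend-∘ _ C.○ _ C.∘⟨ p C.○ C.≈-sym (extend-∘ _)))
      }

  inducedMonad : Monad C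
  inducedMonad = record
    { functor     = T
    ; η           = unit
    ; μ           = λ X → U₁ (ε (Free X))
    ; η-natural   = λ f → C.≈-sym (extend-∘ _)
    ; μ-natural   = λ f → C.≈-sym U-∘ C.○ U-resp (ε-natural (L₁ f)) C.○ U-∘
    ; μ-assoc     = C.≈-sym U-∘ C.○ U-resp (ε-natural (ε _)) C.○ U-∘
    ; μ-identityˡ = C.≈-sym U-∘ C.○ U-resp (uniq₂ _ D.id
                      (step (extend-∘ _) C.○ C.≈-sym C.assoc C.○ extend-∘ _ C.⟩∘ _ C.○
                       C.identityˡ C.○ C.≈-sym (U-id C.⟩∘ _ C.○ C.identityˡ))) C.○ U-id
    ; μ-identityʳ = extend-∘ _
    }

record InitialAlgebra {o ℓ e} {C : Category o ℓ e} (H : Functor C C) : Set (o ⊔ ℓ ⊔ e) where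
  open Category C
  open Functor H renaming (F₀ to H₀; F₁ to H₁; identity to H-id; homomorphism to H-∘)
  field
    carrier   : Obj
    α         : H₀ carrier ⇒ carrier
    fold      : ∀ {A} → H₀ A ⇒ A → carrier ⇒ A
    fold-comm : ∀ {A} (a : H₀ A ⇒ A) → fold a ∘ α ≈ a ∘ H₁ (fold a)
    fold-uniq : ∀ {A} {a : H₀ A ⇒ A} (h : carrier ⇒ A) → h ∘ α ≈ a ∘ H₁ h → h ≈ fold a

  α⁻¹ : carrier ⇒ H₀ carrier
  α⁻¹ = fold (H₁ α)

  fold-uniq₂ : ∀ {A} (a : H₀ A ⇒ A) (h k : carrier ⇒ A) →
               h ∘ α ≈ a ∘ H₁ h → k ∘ α ≈ a ∘ H₁ k → h ≈ k
  fold-uniq₂ a h k p q = fold-uniq h p ○ ≈-sym (fold-uniq k q)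

  α∘α⁻¹ : α ∘ α⁻¹ ≈ id
  α∘α⁻¹ = fold-uniq₂ α _ _
    (assoc ○ _ ∘⟨ (fold-comm _ ○ ≈-sym H-∘))
    (identityˡ ○ ≈-sym (_ ∘⟨ H-id ○ identityʳ))

  α⁻¹∘α : α⁻¹ ∘ α ≈ id
  α⁻¹∘α = fold-comm _ ○ ≈-sym H-∘ ○ Functor.F-resp-≈ H α∘α⁻¹ ○ H-id

-- R X = μy. T (F y + X), for an arbitrary choice of initial algebras.
module Resumption {o ℓ e} {C : Category o ℓ e} (coproducts : BinaryCoproducts C)
                  (T : Monad C) (F : Functor C C) where
  open Category C
  open BinaryCoproducts coproducts
  open Monad T
  open Functor F using (F₀; F₁; identity; homomorphism; F-resp-≈)

  Step : Obj → Functor C C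
  Step X = record
    { F₀           = λ Y → T₀ (F₀ Y ∐ X)
    ; F₁           = λ f → T₁ (F₁ f ∐₁ id)
    ; identity     = T-resp-≈ (∐₁-resp-≈ identity ≈-refl ○ ∐₁-id) ○ T-identity
    ; homomorphism = T-resp-≈ (∐₁-resp-≈ homomorphism (≈-sym identityˡ) ○ ∐₁-∘) ○ T-homomorphism
    ; F-resp-≈     = λ p → T-resp-≈ (∐₁-resp-≈ (F-resp-≈ p) ≈-refl)
    }

  module _ (I : ∀ X → InitialAlgebra (Step X)) where
    private module I X = InitialAlgebra (I X)

    R₀ : Obj → Obj
    R₀ X = I.carrier X

    R₁ : ∀ {X Y} → X ⇒ Y → R₀ X ⇒ R₀ Y
    R₁ {X} {Y} f = I.fold X (I.α Y ∘ T₁ (id ∐₁ f))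

    private
      swap : ∀ {A B X Y} {g : A ⇒ B} {f : X ⇒ Y} →
             T₁ (id ∐₁ f) ∘ T₁ (F₁ g ∐₁ id) ≈ T₁ (F₁ g ∐₁ id) ∘ T₁ (id ∐₁ f)
      swap = ≈-sym T-homomorphism
           ○ T-resp-≈ (≈-sym ∐₁-∘ ○ ∐₁-resp-≈ (identityˡ ○ ≈-sym identityʳ) (identityʳ ○ ≈-sym identityˡ) ○ ∐₁-∘)
           ○ T-homomorphism

      R-id : ∀ {X} → R₁ (id {X}) ≈ id
      R-id {X} = ≈-sym (I.fold-uniq X id (identityˡ ○
        ≈-sym (assoc ○ _ ∘⟨ (≈-sym T-homomorphism ○ T-resp-≈ (≈-sym ∐₁-∘ ○
          ∐₁-resp-≈ (identityˡ ○ identity) identityˡ ○ ∐₁-id) ○ T-identity) ○ identityʳ)))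

      R-∘ : ∀ {X Y Z} {f : X ⇒ Y} {g : Y ⇒ Z} → R₁ (g ∘ f) ≈ R₁ g ∘ R₁ f
      R-∘ {X} {Y} {Z} {f} {g} = ≈-sym (I.fold-uniq X (R₁ g ∘ R₁ f)
        ( assoc ○ _ ∘⟨ I.fold-comm X _ ○ ≈-sym assoc ○ ≈-sym assoc ⟩∘ _
        ○ (I.fold-comm Y _ ⟩∘ _) ⟩∘ _
        ○ assoc ○ assoc ○ assoc
        ○ _ ∘⟨ (_ ∘⟨ (≈-sym assoc ○ ≈-sym swap ⟩∘ _ ○ assoc) ○ ≈-sym assoc ○
             ∘-resp-≈ (≈-sym T-homomorphism ○ T-resp-≈ (≈-sym ∐₁-∘ ○ ∐₁-resp-≈ identityˡ ≈-refl))
                      (≈-sym T-homomorphism ○ T-resp-≈ (≈-sym ∐₁-∘ ○ ∐₁-resp-≈ (≈-sym homomorphism) identityˡ)))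
        ○ ≈-sym assoc ))

      R-resp : ∀ {X Y} {f g : X ⇒ Y} → f ≈ g → R₁ f ≈ R₁ g
      R-resp {X} p = I.fold-uniq X _ (I.fold-comm X _ ○
        (_ ∘⟨ T-resp-≈ (∐₁-resp-≈ ≈-refl p)) ⟩∘ _)

    R : Functor C C
    R = record { F₀ = R₀ ; F₁ = R₁ ; identity = R-id ; homomorphism = R-∘ ; F-resp-≈ = R-resp }

    T-structure : ∀ X → T₀ (R₀ X) ⇒ R₀ X
    T-structure X = I.α X ∘ μ _ ∘ T₁ (I.α⁻¹ X)

    F-structure : ∀ X → F₀ (R₀ X) ⇒ R₀ X
    F-structure X = I.α X ∘ η _ ∘ inl

    R-unit : ∀ X → X ⇒ R₀ X
    R-unit X = I.α X ∘ η _ ∘ inr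

    record IsMultiplication {X} (m : R₀ (R₀ X) ⇒ R₀ X) : Set e where
      field
        T-hom     : m ∘ T-structure (R₀ X) ≈ T-structure X ∘ T₁ m
        F-hom     : m ∘ F-structure (R₀ X) ≈ F-structure X ∘ F₁ m
        restricts : m ∘ R-unit (R₀ X) ≈ id

    record CanonicalMonad : Set (o ⊔ ℓ ⊔ e) where
      field
        mult             : ∀ X → R₀ (R₀ X) ⇒ R₀ X
        isMultiplication : ∀ X → IsMultiplication (mult X)
        mult-unique      : ∀ {X} (m : R₀ (R₀ X) ⇒ R₀ X) → IsMultiplication m → m ≈ mult X
        unit-natural     : ∀ {X Y} (f : X ⇒ Y) → R-unit Y ∘ f ≈ R₁ f ∘ R-unit X
        mult-natural     : ∀ {X Y} (f : X ⇒ Y) → mult Y ∘ R₁ (R₁ f) ≈ R₁ f ∘ mult X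
        mult-assoc       : ∀ {X} → mult X ∘ R₁ (mult X) ≈ mult X ∘ mult (R₀ X)
        mult-identityˡ   : ∀ {X} → mult X ∘ R₁ (R-unit X) ≈ id
        mult-identityʳ   : ∀ {X} → mult X ∘ R-unit (R₀ X) ≈ id

      monad : Monad C
      monad = record
        { functor     = R
        ; η           = R-unit
        ; μ           = mult
        ; η-natural   = unit-natural
        ; μ-natural   = mult-natural
        ; μ-assoc     = mult-assoc
        ; μ-identityˡ = mult-identityˡ
        ; μ-identityʳ = mult-identityʳ
        }

-- An extended nonnegative real a is given by the set of rationals q with a ≤ q, written a ⊑ q.
-- The empty set is ∞.
record [0,∞] : Set₁ where
  infix 4 _⊑_
  field
    _⊑_      : ℚ≥0 → Set
    ⊑-upper  : ∀ {p q} → p ≤ q → _⊑_ p → _⊑_ q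
    ⊑-closed : ∀ {q} → (∀ h → 0# < h → _⊑_ (q + h)) → _⊑_ q

open [0,∞] public

infix 4 _≤∞_ _≈∞_ _<∞_

_≤∞_ _≈∞_ _<∞_ : [0,∞] → [0,∞] → Set
a ≤∞ b = ∀ q → b ⊑ q → a ⊑ q
a ≈∞ b = a ≤∞ b × b ≤∞ a

⌊_⌋ : ℚ≥0 → [0,∞]
⌊ p ⌋ ._⊑_ q = p ≤ q
⌊ p ⌋ .⊑-upper a b = ≤-trans b a
⌊ p ⌋ .⊑-closed {q} f with ≤-total p q
... | inj₁ p≤q = p≤q
... | inj₂ q≤p with ℚ.<-cmp (val q) (val p)
...   | tri< q<p _ _ = contradict (<-gap (<⁺ q<p))
  where
  contradict : (∃[ r ] (0# < r × q + r ≡ p)) → p ≤ q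
  contradict (r , r>0 , refl) with half r>0
  ... | h , h>0 , refl = ⊥-elim (<⇒≱ (p<p+q h>0)
          (subst (_≤ q + h) (sym (+-assoc q h h)) (f h h>0)))
...   | tri≈ _ q≡p _ = ≤-reflexive (sym (val≡ q≡p))
...   | tri> _ _ p<q = <⇒≤ (<⁺ p<q)

a <∞ b = ∃₂ λ p q → a ⊑ p × p < q × ⌊ q ⌋ ≤∞ b

0∞ 1∞ : [0,∞]
0∞ = ⌊ 0# ⌋
1∞ = ⌊ 1# ⌋

-- a + b and a · b are the infima of p + q and p · q over rationals p ≥ a, q ≥ b;
-- in particular c · ∞ = ∞.
private
  module Inf (_∙_ : ℚ≥0 → ℚ≥0 → ℚ≥0) (a b : [0,∞]) where
    inf : [0,∞]
    inf ._⊑_ r = ∀ h → 0# < h → ∃₂ λ p q → a ⊑ p × b ⊑ q × p ∙ q ≤ r + h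
    inf .⊑-upper r≤s f h h>0 with f h h>0
    ... | p , q , ap , bq , le = p , q , ap , bq , ≤-trans le (+-mono-≤ r≤s ≤-refl)
    inf .⊑-closed {r} f h h>0 with half h>0
    ... | k , k>0 , refl with f k k>0 k k>0
    ...   | p , q , ap , bq , le = p , q , ap , bq , ≤-trans le (≤-reflexive (+-assoc r k k))

infixl 6 _+∞_
infixl 7 _*∞_

_+∞_ _*∞_ : [0,∞] → [0,∞] → [0,∞]
_+∞_ = Inf.inf _+_
_*∞_ = Inf.inf _*_

+∞-⊑ : ∀ a b {p q} → a ⊑ p → b ⊑ q → a +∞ b ⊑ p + q
+∞-⊑ a b ap bq h _ = _ , _ , ap , bq , p≤p+q

*∞-⊑ : ∀ a b {p q} → a ⊑ p → b ⊑ q → a *∞ b ⊑ p * q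
*∞-⊑ a b ap bq h _ = _ , _ , ap , bq , p≤p+q

-- An element of [0,∞] is real if it is finite and its cut is located (a Dedekind cut).
record ℝ≥0 : Set₁ where
  field
    real    : [0,∞]
    finite  : ∃[ q ] (real ⊑ q)
    located : ∀ {p q} → p < q → real ⊑ q ⊎ ¬ (real ⊑ p)

open ℝ≥0 public

ι : ℚ≥0 → ℝ≥0
ι p .real = ⌊ p ⌋
ι p .finite = p , ≤-refl
ι p .located {q} {r} q<r with ≤-total p r
... | inj₁ p≤r = inj₁ p≤r
... | inj₂ r≤p = inj₂ λ p≤q → <⇒≱ q<r (≤-trans r≤p p≤q)

-- ∣ x - y ∣ ≤ ε, without subtraction
_∼⟨_⟩_ : ℝ≥0 → ℚ≥0 → ℝ≥0 → Set
x ∼⟨ ε ⟩ y = real x ≤∞ real y +∞ ⌊ ε ⌋ × real y ≤∞ real x +∞ ⌊ ε ⌋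

IsContinuous : ∀ {n} → ((Fin n → ℝ≥0) → ℝ≥0) → Set₁
IsContinuous {n} f = ∀ x ε → 0# < ε → Σ[ δ ∈ ℚ≥0 ] (0# < δ ×
  (∀ y → (∀ i → x i ∼⟨ δ ⟩ y i) → f x ∼⟨ ε ⟩ f y))

record Met : Set₁ where
  field
    setoid : Setoid 0ℓ 0ℓ
  open Setoid setoid public using (Carrier; _≈_)
    renaming (refl to ≈-refl; sym to ≈-sym; trans to ≈-trans; isEquivalence to ≈-equiv)
  field
    d       : Carrier → Carrier → [0,∞]
    d-zero  : ∀ {x y} → d x y ≈∞ 0∞ ⇔ x ≈ y
    d-sym   : ∀ {x y} → d x y ≈∞ d y x
    d-tri   : ∀ {x y z} → d x z ≤∞ d x y +∞ d y z

  ball-sym : ∀ {x y r} → d x y ⊑ r → d y x ⊑ r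
  ball-sym {x} {y} {r} p = proj₁ (d-sym {y} {x}) r p

  ball-tri : ∀ {x y z r s} → d x y ⊑ r → d y z ⊑ s → d x z ⊑ r + s
  ball-tri {x} {y} {z} p q = d-tri _ (+∞-⊑ (d x y) (d y z) p q)

  ≈⇒ball : ∀ {x y r} → x ≈ y → d x y ⊑ r
  ≈⇒ball {r = r} p = proj₁ (Equivalence.from d-zero p) r 0≤

  ball⇒≈ : ∀ {x y} → d x y ⊑ 0# → x ≈ y
  ball⇒≈ {x} {y} p = Equivalence.to d-zero ((λ q _ → ⊑-upper (d x y) 0≤ p) , (λ _ _ → 0≤))

  ball-resp : ∀ {x x′ y y′ r} → x ≈ x′ → y ≈ y′ → d x y ⊑ r → d x′ y′ ⊑ r
  ball-resp {r = r} p q b = subst (d _ _ ⊑_) (trans (+-identityʳ _) (+-identityˡ r))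
    (ball-tri (ball-tri (≈⇒ball {r = 0#} (≈-sym p)) b) (≈⇒ball {r = 0#} q))

∣_∣ : Met → Set
∣ X ∣ = Met.Carrier X

-- A metric given by the relations d(x,y) ≤ r. There are no quotients, so points at distance 0
-- are identified through the setoid equality.
module FromBalls (A : Set) (_∼[_]_ : A → ℚ≥0 → A → Set)
  (upper : ∀ {x y p q} → p ≤ q → x ∼[ p ] y → x ∼[ q ] y)
  (closed : ∀ {x y q} → (∀ h → 0# < h → x ∼[ q + h ] y) → x ∼[ q ] y)
  (∼-refl : ∀ {x} → x ∼[ 0# ] x)
  (∼-sym : ∀ {x y r} → x ∼[ r ] y → y ∼[ r ] x)
  (∼-tri : ∀ {x y z r s} → x ∼[ r ] y → y ∼[ s ] z → x ∼[ r + s ] z) where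

  met : Met
  met = record
    { setoid = record
      { Carrier = A
      ; _≈_ = λ x y → x ∼[ 0# ] y
      ; isEquivalence = record { refl = ∼-refl ; sym = ∼-sym
          ; trans = λ p q → upper (≤-reflexive (+-identityʳ 0#)) (∼-tri p q) } }
    ; d = λ x y → record { _⊑_ = λ r → x ∼[ r ] y ; ⊑-upper = upper ; ⊑-closed = closed }
    ; d-zero = mk⇔ (λ p → proj₁ p 0# ≤-refl) (λ p → (λ _ _ → upper 0≤ p) , (λ _ _ → 0≤))
    ; d-sym = (λ _ → ∼-sym) , (λ _ → ∼-sym)
    ; d-tri = λ r f → closed λ h h>0 → let (_ , _ , p , q , le) = f h h>0 in upper le (∼-tri p q)
    }

record NonExpansive (X Y : Met) : Set where
  constructor ne
  field
    fun    : ∣ X ∣ → ∣ Y ∣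
    nonexp : ∀ x y → Met.d Y (fun x) (fun y) ≤∞ Met.d X x y

  resp : ∀ {x y} → Met._≈_ X x y → Met._≈_ Y (fun x) (fun y)
  resp p = Met.ball⇒≈ Y (nonexp _ _ 0# (Met.≈⇒ball X p))

open NonExpansive public

Cauchy : (X : Met) → (ℕ → ∣ X ∣) → Set
Cauchy X s = ∀ ε → 0# < ε → ∃[ N ] (∀ m n → N ℕ.≤ m → N ℕ.≤ n → Met.d X (s m) (s n) ⊑ ε)

Converges : (X : Met) → (ℕ → ∣ X ∣) → ∣ X ∣ → Set
Converges X s x = ∀ ε → 0# < ε → ∃[ N ] (∀ n → N ℕ.≤ n → Met.d X (s n) x ⊑ ε)

Complete : Met → Set
Complete X = ∀ s → Cauchy X s → ∃[ x ] Converges X s x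

record CMet : Set₁ where
  constructor _,_
  field
    space    : Met
    complete : Complete space

open CMet public

idNE : ∀ {X} → NonExpansive X X
idNE = ne (λ x → x) (λ _ _ _ p → p)

_∘NE_ : ∀ {X Y Z} → NonExpansive Y Z → NonExpansive X Y → NonExpansive X Z
g ∘NE f = ne (λ x → fun g (fun f x)) (λ x y r p → nonexp g _ _ r (nonexp f x y r p))

CMET : Category (lsuc 0ℓ) 0ℓ 0ℓ
CMET = record
  { Obj       = CMet
  ; _⇒_       = λ X Y → NonExpansive (space X) (space Y)
  ; _≈_       = λ {X} {Y} f g → ∀ x → Met._≈_ (space Y) (fun f x) (fun g x)
  ; id        = idNE
  ; _∘_       = _∘NE_
  ; equiv     = λ {X} {Y} → record
    { refl  = λ x → Met.≈-refl (space Y)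
    ; sym   = λ p x → Met.≈-sym (space Y) (p x)
    ; trans = λ p q x → Met.≈-trans (space Y) (p x) (q x) }
  ; ∘-resp-≈  = λ {_} {_} {Z} {f} {f′} p q x → Met.≈-trans (space Z) (resp f (q x)) (p _)
  ; assoc     = λ {_} {_} {_} {D} x → Met.≈-refl (space D)
  ; identityˡ = λ {_} {B} x → Met.≈-refl (space B)
  ; identityʳ = λ {_} {B} x → Met.≈-refl (space B)
  }

module Limits (X : Met) where
  open Met X

  limit-ball : ∀ {s t x y r} → Converges X s x → Converges X t y →
               (∀ h → 0# < h → ∃[ N ] (∀ n → N ℕ.≤ n → d (s n) (t n) ⊑ r + h)) → d x y ⊑ r
  limit-ball {s} {t} {x} {y} {r} sx ty st = ⊑-closed (d x y) λ h h>0 → go h h>0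
    where
    go : ∀ h → 0# < h → d x y ⊑ r + h
    go h h>0 with half h>0
    ... | k , k>0 , refl with half k>0
    ...   | l , l>0 , refl with sx l l>0 | ty l l>0 | st (l + l) k>0
    ...     | N₁ , p | N₂ , q | N₃ , u =
      let n = N₁ ℕ.⊔ (N₂ ℕ.⊔ N₃)
          a = ℕ.m≤m⊔n N₁ _
          b = ℕ.≤-trans (ℕ.m≤m⊔n N₂ N₃) (ℕ.m≤n⊔m N₁ _)
          c = ℕ.≤-trans (ℕ.m≤n⊔m N₂ N₃) (ℕ.m≤n⊔m N₁ _)
      in subst (d x y ⊑_) (+-regroup r l)
           (ball-tri (ball-sym (p n a)) (ball-tri (u n c) (q n b)))

  limit-unique : ∀ {s x y} → Converges X s x → Converges X s y → x ≈ y
  limit-unique p q = ball⇒≈ (limit-ball p q (λ h _ → 0 , λ n _ → ≈⇒ball ≈-refl))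

  limit-resp : ∀ {s t x} → (∀ n → s n ≈ t n) → Converges X s x → Converges X t x
  limit-resp e p ε ε>0 with p ε ε>0
  ... | N , q = N , λ n le → ball-resp (e n) ≈-refl (q n le)

module _ {X Y : Met} (f : NonExpansive X Y) where
  map-Cauchy : ∀ {s} → Cauchy X s → Cauchy Y (λ n → fun f (s n))
  map-Cauchy c ε ε>0 with c ε ε>0
  ... | N , p = N , λ m n a b → nonexp f _ _ ε (p m n a b)

  map-Converges : ∀ {s x} → Converges X s x → Converges Y (λ n → fun f (s n)) (fun f x)
  map-Converges c ε ε>0 with c ε ε>0
  ... | N , p = N , λ n a → nonexp f _ _ ε (p n a)

maximum : ∀ {n} → (Fin n → ℕ) → ℕ
maximum {zero}  f = 0
maximum {suc n} f = f zero ℕ.⊔ maximum (λ i → f (suc i))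

≤-maximum : ∀ {n} (f : Fin n → ℕ) i → f i ℕ.≤ maximum f
≤-maximum f zero    = ℕ.m≤m⊔n _ _
≤-maximum f (suc i) = ℕ.≤-trans (≤-maximum (λ i → f (suc i)) i) (ℕ.m≤n⊔m _ _)

module _ (n : ℕ) (X : Met) where
  private module X = Met X

  -- max d(xᵢ,yᵢ) ≤ r iff d(xᵢ,yᵢ) ≤ r for all i
  Power : Met
  Power = FromBalls.met (Fin n → ∣ X ∣) (λ x r y → ∀ i → X.d (x i) (y i) ⊑ r)
    (λ le p i → ⊑-upper (X.d _ _) le (p i))
    (λ f i → ⊑-closed (X.d _ _) λ h h>0 → f h h>0 i)
    (λ i → X.≈⇒ball X.≈-refl)
    (λ p i → X.ball-sym (p i))
    (λ p q i → X.ball-tri (p i) (q i))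

module _ (n : ℕ) (X : Met) where
  Power-Converges : ∀ {s x} → (∀ i → Converges X (λ k → s k i) (x i)) → Converges (Power n X) s x
  Power-Converges c ε ε>0 = maximum (λ i → proj₁ (c i ε ε>0)) ,
    λ k le i → proj₂ (c i ε ε>0) k (ℕ.≤-trans (≤-maximum (λ i → proj₁ (c i ε ε>0)) i) le)

  Power-Cauchy : ∀ {s} → (∀ i → Cauchy X (λ k → s k i)) → Cauchy (Power n X) s
  Power-Cauchy c ε ε>0 = maximum N , λ k l a b i → proj₂ (c i ε ε>0) k l
      (ℕ.≤-trans (≤-maximum N i) a) (ℕ.≤-trans (≤-maximum N i) b)
    where
    N : Fin n → ℕ
    N i = proj₁ (c i ε ε>0)

  Power-complete : Complete X → Complete (Power n X)
  Power-complete compl s c = (λ i → proj₁ (lim i)) , Power-Converges (λ i → proj₂ (lim i))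
    where
    lim : ∀ i → ∃[ x ] Converges X (λ k → s k i) x
    lim i = compl (λ k → s k i) λ ε ε>0 → let (N , p) = c ε ε>0 in N , λ m n a b → p m n a b i

module _ (c : ℝ≥0) (X : Met) where
  private module X = Met X

  private
    common : ∀ {a b p q} → real c ⊑ a → real c ⊑ b →
             Σ[ m ∈ ℚ≥0 ] (real c ⊑ m × m * p ≤ a * p × m * q ≤ b * q)
    common {a} {b} ca cb with ≤-total a b
    ... | inj₁ a≤b = a , ca , ≤-refl , *-mono-≤ a≤b ≤-refl
    ... | inj₂ b≤a = b , cb , *-mono-≤ b≤a ≤-refl , ≤-refl

    tri : ∀ {x y z r s} → real c *∞ X.d x y ⊑ r → real c *∞ X.d y z ⊑ s → real c *∞ X.d x z ⊑ r + s
    tri {r = r} {s} f g h h>0 with half h>0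
    ... | k , k>0 , refl with f k k>0 | g k k>0
    ...   | a , p , ca , dp , u | b , q , cb , dq , v with common {p = p} {q} ca cb
    ...     | m , cm , u′ , v′ = m , p + q , cm , X.ball-tri dp dq ,
      ≤-trans (≤-reflexive (*-distribˡ-+ m p q))
        (≤-trans (+-mono-≤ (≤-trans u′ u) (≤-trans v′ v)) (≤-reflexive (+-interchange r k s k)))

  Scale-≈ : ∀ {x y} → x X.≈ y → real c *∞ X.d x y ⊑ 0#
  Scale-≈ p h _ = proj₁ (finite c) , 0# , proj₂ (finite c) , X.≈⇒ball p ,
    ≤-trans (≤-reflexive (*-zeroʳ (proj₁ (finite c)))) 0≤

  Scale : Met
  Scale = FromBalls.met ∣ X ∣ (λ x r y → real c *∞ X.d x y ⊑ r)
    (⊑-upper (real c *∞ X.d _ _))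
    (⊑-closed (real c *∞ X.d _ _))
    (Scale-≈ X.≈-refl)
    (λ f h h>0 → let (a , p , ca , dp , le) = f h h>0 in a , p , ca , X.ball-sym dp , le)
    tri

⊑-1 : ∀ {a} → a <∞ 1∞ → a ⊑ 1#
⊑-1 {a} (p , q , ap , p<q , q≤1) = ⊑-upper a (≤-trans (<⇒≤ p<q) (q≤1 1# ≤-refl)) ap

module _ (c : ℝ≥0) (0<c : 0∞ <∞ real c) (X : Met) where
  private
    module X = Met X
    q = proj₁ (proj₂ 0<c)
    q>0 : 0# < q
    q>0 = ≤-<-trans 0≤ (proj₁ (proj₂ (proj₂ (proj₂ 0<c))))

    cancel : ∀ {x y r} → Met.d (Scale c X) x y ⊑ q * r → X.d x y ⊑ r
    cancel {x} {y} {r} f = ⊑-closed (X.d x y) λ h h>0 → go h (f (q * h) (*-pos q>0 h>0))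
      where
      go : ∀ h → (∃₂ λ a p → real c ⊑ a × X.d x y ⊑ p × a * p ≤ q * r + q * h) → X.d x y ⊑ r + h
      go h (a , p , ca , dp , le) = ⊑-upper (X.d x y)
        (*-cancelˡ-≤ q q>0 (≤-trans (*-mono-≤ (proj₂ (proj₂ (proj₂ (proj₂ 0<c))) a ca) ≤-refl)
          (≤-trans le (≤-reflexive (sym (*-distribˡ-+ q r h)))))) dp

  Scale-complete : real c <∞ 1∞ → Complete X → Complete (Scale c X)
  Scale-complete c<1 compl s cauchy with compl s (λ ε ε>0 →
    let (N , p) = cauchy (q * ε) (*-pos q>0 ε>0) in N , λ m n a b → cancel (p m n a b))
  ... | x , lim = x , λ ε ε>0 → let (N , p) = lim ε ε>0 in N , λ n a →
    subst (real c *∞ X.d (s n) x ⊑_) (*-identityˡ ε) (*∞-⊑ (real c) (X.d (s n) x) (⊑-1 {real c} c<1) (p n a))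

module _ (I : Set) (X : I → Met) where

  -- There is no constructor across summands: their distance is ∞.
  data SumBall : Σ[ i ∈ I ] ∣ X i ∣ → ℚ≥0 → Σ[ i ∈ I ] ∣ X i ∣ → Set where
    same : ∀ {i x y r} → Met.d (X i) x y ⊑ r → SumBall (i , x) r (i , y)

  unsame : ∀ {i x y r} → SumBall (i , x) r (i , y) → Met.d (X i) x y ⊑ r
  unsame (same p) = p

  private
    closed : ∀ {u v q} → (∀ h → 0# < h → SumBall u (q + h) v) → SumBall u q v
    closed {u} {v} f with f 1# 0<1
    ... | same {i} {x} {y} _ = same (⊑-closed (Met.d (X i) x y) λ h h>0 → unsame (f h h>0))

  Sum : Met
  Sum = FromBalls.met (Σ[ i ∈ I ] ∣ X i ∣) SumBall
    (λ { le (same p) → same (⊑-upper (Met.d (X _) _ _) le p) })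
    closed
    (λ { {i , _} → same (Met.≈⇒ball (X i) (Met.≈-refl (X i))) })
    (λ { (same p) → same (Met.ball-sym (X _) p) })
    (λ { (same p) (same q) → same (Met.ball-tri (X _) p q) })

  private
    component : ∀ {i x r v} → SumBall (i , x) r v → Σ[ y ∈ ∣ X i ∣ ] (v ≡ (i , y))
    component (same _) = _ , refl

  Sum-complete : (∀ i → Complete (X i)) → Complete Sum
  Sum-complete compl s cauchy with cauchy 1# 0<1
  ... | N , near = (i , proj₁ lim) , conv
    where
    i = proj₁ (s N)
    comp : ∀ k → Σ[ y ∈ ∣ X i ∣ ] (s (N ℕ.+ k) ≡ (i , y))
    comp k = component (near N (N ℕ.+ k) ℕ.≤-refl (ℕ.m≤m+n N k))
    t : ℕ → ∣ X i ∣
    t k = proj₁ (comp k)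
    lim = compl i t λ ε ε>0 → let (M , p) = cauchy ε ε>0 in M , λ m n a b →
      unsame (subst₂ (λ u v → SumBall u ε v) (proj₂ (comp m)) (proj₂ (comp n))
        (p (N ℕ.+ m) (N ℕ.+ n) (ℕ.≤-trans a (ℕ.m≤n+m m N)) (ℕ.≤-trans b (ℕ.m≤n+m n N))))
    conv : Converges Sum s (i , proj₁ lim)
    conv ε ε>0 = let (M , p) = proj₂ lim ε ε>0 in N ℕ.+ M , λ n a →
      subst (λ n → SumBall (s n) ε (i , proj₁ lim)) (ℕ.m+[n∸m]≡n (ℕ.≤-trans (ℕ.m≤m+n N M) a))
        (subst (λ u → SumBall u ε (i , proj₁ lim)) (sym (proj₂ (comp (n ℕ.∸ N))))
          (same (p (n ℕ.∸ N) (subst (ℕ._≤ n ℕ.∸ N) (ℕ.m+n∸m≡n N M) (ℕ.∸-monoˡ-≤ N a)))))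

-- As a set Sum Bool (pick A B) is the disjoint union, with true tagging A.
⊎-coproducts : BinaryCoproducts CMET
⊎-coproducts = record
  { _∐_     = λ A B → Sum Bool (pick A B) , Sum-complete Bool (pick A B) (pick-complete A B)
  ; inl     = ne (true ,_) λ _ _ _ p → same p
  ; inr     = ne (false ,_) λ _ _ _ p → same p
  ; [_,_]   = λ f g → ne (λ { (true , x) → fun f x ; (false , y) → fun g y })
                λ { _ _ r (same {true} p) → nonexp f _ _ r p ; _ _ r (same {false} p) → nonexp g _ _ r p }
  ; inject₁ = λ {_} {_} {D} _ → Met.≈-refl (space D)
  ; inject₂ = λ {_} {_} {D} _ → Met.≈-refl (space D)
  ; unique  = λ { {_} {_} {D} p q (true , x) → Met.≈-sym (space D) (p x)
                ; {_} {_} {D} p q (false , y) → Met.≈-sym (space D) (q y) }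
  }
  where
  pick : CMet → CMet → Bool → Met
  pick A B b = if b then space A else space B
  pick-complete : ∀ A B b → Complete (pick A B b)
  pick-complete A B true  = complete A
  pick-complete A B false = complete B

module _ (X : Met) where
  private module X = Met X

  record Fundamental : Set where
    constructor _,_
    field
      seq    : ℕ → ∣ X ∣
      cauchy : Cauchy X seq

  open Fundamental public

  private
    -- d(s,t) = lim d(sₙ,tₙ)
    Ball : Fundamental → ℚ≥0 → Fundamental → Set
    Ball s r t = ∀ h → 0# < h → ∃[ N ] (∀ n → N ℕ.≤ n → X.d (seq s n) (seq t n) ⊑ r + h)

    closed : ∀ {s t q} → (∀ h → 0# < h → Ball s (q + h) t) → Ball s q t
    closed {s} {t} {q} f h h>0 with half h>0
    ... | k , k>0 , refl with f k k>0 k k>0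
    ...   | N , p = N , λ n a → subst (X.d (seq s n) (seq t n) ⊑_) (+-assoc q k k) (p n a)

    tri : ∀ {s t u p q} → Ball s p t → Ball t q u → Ball s (p + q) u
    tri {s} {_} {u} {p} {q} f g h h>0 with half h>0
    ... | k , k>0 , refl with f k k>0 | g k k>0
    ...   | N , a | M , b = N ℕ.⊔ M , λ n le →
      subst (X.d (seq s n) (seq u n) ⊑_) (+-interchange p k q k)
        (X.ball-tri (a n (ℕ.≤-trans (ℕ.m≤m⊔n N M) le)) (b n (ℕ.≤-trans (ℕ.m≤n⊔m N M) le)))

  Completion : Met
  Completion = FromBalls.met Fundamental Ball
    (λ le f h h>0 → let (N , p) = f h h>0 in
      N , λ n a → ⊑-upper (X.d _ _) (+-mono-≤ le ≤-refl) (p n a))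
    (λ {s} {t} → closed {s} {t})
    (λ h _ → 0 , λ n _ → X.≈⇒ball X.≈-refl)
    (λ f h h>0 → let (N , p) = f h h>0 in N , λ n a → X.ball-sym (p n a))
    (λ {s} {t} {u} → tri {s} {t} {u})

  private module X̄ = Met Completion

  pointwise-≈ : ∀ {s t} → (∀ n → seq s n X.≈ seq t n) → s X̄.≈ t
  pointwise-≈ e h _ = 0 , λ n _ → X.≈⇒ball (e n)

  embed : NonExpansive X Completion
  embed = ne (λ x → (λ _ → x) , λ ε _ → 0 , λ _ _ _ _ → X.≈⇒ball X.≈-refl)
             (λ x y r p h _ → 0 , λ _ _ → ⊑-upper (X.d x y) p≤p+q p)

  embed-reflects : ∀ {x y r} → X̄.d (fun embed x) (fun embed y) ⊑ r → X.d x y ⊑ r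
  embed-reflects {x} {y} f = ⊑-closed (X.d x y) λ h h>0 → let (N , p) = f h h>0 in p N ℕ.≤-refl

  embed-near : ∀ s {ε} N → (∀ m n → N ℕ.≤ m → N ℕ.≤ n → X.d (seq s m) (seq s n) ⊑ ε) →
               ∀ n → N ℕ.≤ n → X̄.d (fun embed (seq s n)) s ⊑ ε
  embed-near s N p n a h _ = N , λ m b → ⊑-upper (X.d _ _) p≤p+q (p n m a b)

  embed-dense : ∀ s → Converges Completion (λ n → fun embed (seq s n)) s
  embed-dense s ε ε>0 = let (N , p) = cauchy s ε ε>0 in N , embed-near s N p

  Completion-complete : Complete Completion
  Completion-complete S Sc = t , S→t
    where
    N : ℕ → ℕ
    N k = proj₁ (cauchy (S k) (1/suc k) (1/suc-pos k))
    u : ℕ → ∣ X ∣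
    u k = seq (S k) (N k)
    near : ∀ k → X̄.d (fun embed (u k)) (S k) ⊑ 1/suc k
    near k = embed-near (S k) (N k) (proj₂ (cauchy (S k) (1/suc k) (1/suc-pos k))) (N k) ℕ.≤-refl
    u-cauchy : Cauchy X u
    u-cauchy ε ε>0 with half ε>0
    ... | h , h>0 , refl with half h>0
    ...   | k , k>0 , refl with Sc k k>0 | archimedean k>0
    ...     | M , p | K , le = M ℕ.⊔ K , λ m n a b →
      ⊑-upper (X.d (u m) (u n)) (≤-reflexive (+-assoc (k + k) k k)) (⊑-upper (X.d (u m) (u n)) p≤p+q
      (embed-reflects (X̄.ball-tri {fun embed (u m)} {S n} {fun embed (u n)} (X̄.ball-tri {fun embed (u m)} {S m} {S n}
        (⊑-upper (X̄.d (fun embed (u m)) (S m)) (small m a) (near m))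
        (p m n (ℕ.≤-trans (ℕ.m≤m⊔n M K) a) (ℕ.≤-trans (ℕ.m≤m⊔n M K) b)))
        (X̄.ball-sym {fun embed (u n)} {S n} (⊑-upper (X̄.d (fun embed (u n)) (S n)) (small n b) (near n))))))
      where
      small : ∀ m → M ℕ.⊔ K ℕ.≤ m → 1/suc m ≤ k
      small m a = ≤-trans (1/suc-anti (ℕ.≤-trans (ℕ.m≤n⊔m M K) a)) le
    t : Fundamental
    t = u , u-cauchy
    S→t : Converges Completion S t
    S→t ε ε>0 with half ε>0
    ... | k , k>0 , refl with embed-dense t k k>0 | archimedean k>0
    ...   | M , p | K , le = M ℕ.⊔ K , λ n a → X̄.ball-tri {S n} {fun embed (u n)} {t}
      (X̄.ball-sym {fun embed (u n)} {S n} (⊑-upper (X̄.d (fun embed (u n)) (S n))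
        (≤-trans (1/suc-anti (ℕ.≤-trans (ℕ.m≤n⊔m M K) a)) le) (near n)))
      (p n (ℕ.≤-trans (ℕ.m≤m⊔n M K) a))

module _ {X Y : Met} (f : NonExpansive X Y) (Y-complete : Complete Y) where
  private
    lim : (s : Fundamental X) → ∃[ y ] Converges Y (λ n → fun f (seq s n)) y
    lim s = Y-complete _ (map-Cauchy f (cauchy s))

  extendCompletion : NonExpansive (Completion X) Y
  extendCompletion = ne (λ s → proj₁ (lim s)) λ s t r p →
    Limits.limit-ball Y (proj₂ (lim s)) (proj₂ (lim t)) λ h h>0 →
      let (N , q) = p h h>0 in N , λ n a → nonexp f _ _ _ (q n a)

  extendCompletion-lim : ∀ s → Converges Y (λ n → fun f (seq s n)) (fun extendCompletion s)
  extendCompletion-lim s = proj₂ (lim s)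

record Signature : Set₁ where
  field
    Op : Set
    ar : Op → ℕ

open Signature public

data Term (S : Signature) (V : Set) : Set where
  var : V → Term S V
  op  : (f : Op S) → (Fin (ar S f) → Term S V) → Term S V

eval : ∀ {S V} {A : Set} → ((f : Op S) → (Fin (ar S f) → A) → A) → (V → A) → Term S V → A
eval φ ρ (var x)  = ρ x
eval φ ρ (op f t) = φ f (λ i → eval φ ρ (t i))

_[_] : ∀ {S V W} → Term S V → (V → Term S W) → Term S W
t [ σ ] = eval op σ t

Var : Set
Var = ℕ

infix 6 _≐[_]_
infix 4 _⊢_

record QEq (S : Signature) : Set where
  constructor _≐[_]_
  field
    lhs : Term S Var
    ε   : ℚ≥0
    rhs : Term S Var

open QEq public

_[_]ᵉ : ∀ {S} → QEq S → (Var → Term S Var) → QEq S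
(t ≐[ ε ] s) [ σ ]ᵉ = t [ σ ] ≐[ ε ] s [ σ ]

-- The finite set of hypotheses is listed; theories do not distinguish lists with the same
-- elements, by assumption and cut.
record CondQEq (S : Signature) : Set where
  constructor _⊢_
  field
    hypotheses : List (QEq S)
    conclusion : QEq S

infix 4 _⊆_
_⊆_ : ∀ {S} → (CondQEq S → Set) → (CondQEq S → Set) → Set
A ⊆ B = ∀ φ → A φ → B φ

record IsTheory {S : Signature} (U : CondQEq S → Set) : Set where
  field
    ≐-refl       : ∀ x → U ([] ⊢ var x ≐[ 0# ] var x)
    ≐-sym        : ∀ x y ε → U (var x ≐[ ε ] var y ∷ [] ⊢ var y ≐[ ε ] var x)
    ≐-triangle   : ∀ x y z ε ε′ →
                   U (var x ≐[ ε ] var z ∷ var z ≐[ ε′ ] var y ∷ [] ⊢ var x ≐[ ε + ε′ ] var y)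
    ≐-weaken     : ∀ x y ε ε′ → 0# < ε′ → U (var x ≐[ ε ] var y ∷ [] ⊢ var x ≐[ ε + ε′ ] var y)
    ≐-nonexp     : ∀ f (x y : Fin (ar S f) → Var) ε →
                   U (tabulate (λ i → var (x i) ≐[ ε ] var (y i)) ⊢
                      op f (λ i → var (x i)) ≐[ ε ] op f (λ i → var (y i)))
    continuity   : ∀ {Γ t s ε} → (∀ ε′ → ε < ε′ → U (Γ ⊢ t ≐[ ε′ ] s)) → U (Γ ⊢ t ≐[ ε ] s)
    substitution : ∀ {Γ φ} (σ : Var → Term S Var) → U (Γ ⊢ φ) → U (map (_[ σ ]ᵉ) Γ ⊢ φ [ σ ]ᵉ)
    assumption   : ∀ {Γ φ} → φ ∈ Γ → U (Γ ⊢ φ)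
    cut          : ∀ {Γ Θ ψ} → (∀ φ → φ ∈ Θ → U (Γ ⊢ φ)) → U (Θ ⊢ ψ) → U (Γ ⊢ ψ)

record Theory (S : Signature) : Set₁ where
  field
    Member   : CondQEq S → Set
    isTheory : IsTheory Member

open Theory public

record _Axiomatizes_ {S : Signature} (A : CondQEq S → Set) (U : Theory S) : Set₁ where
  field
    contained : A ⊆ Member U
    smallest  : ∀ (U′ : Theory S) → A ⊆ Member U′ → Member U ⊆ Member U′

-- The smallest theory containing A: one constructor for each closure condition of IsTheory.
module _ {S : Signature} (A : CondQEq S → Set) where

  data Derivable : CondQEq S → Set where
    axiom        : ∀ {φ} → A φ → Derivable φ
    ≐-refl       : ∀ x → Derivable ([] ⊢ var x ≐[ 0# ] var x)
    ≐-sym        : ∀ x y ε → Derivable (var x ≐[ ε ] var y ∷ [] ⊢ var y ≐[ ε ] var x)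
    ≐-triangle   : ∀ x y z ε ε′ →
                   Derivable (var x ≐[ ε ] var z ∷ var z ≐[ ε′ ] var y ∷ [] ⊢ var x ≐[ ε + ε′ ] var y)
    ≐-weaken     : ∀ x y ε ε′ → 0# < ε′ → Derivable (var x ≐[ ε ] var y ∷ [] ⊢ var x ≐[ ε + ε′ ] var y)
    ≐-nonexp     : ∀ f (x y : Fin (ar S f) → Var) ε →
                   Derivable (tabulate (λ i → var (x i) ≐[ ε ] var (y i)) ⊢
                              op f (λ i → var (x i)) ≐[ ε ] op f (λ i → var (y i)))
    continuity   : ∀ {Γ t s ε} → (∀ ε′ → ε < ε′ → Derivable (Γ ⊢ t ≐[ ε′ ] s)) → Derivable (Γ ⊢ t ≐[ ε ] s)
    substitution : ∀ {Γ φ} (σ : Var → Term S Var) → Derivable (Γ ⊢ φ) → Derivable (map (_[ σ ]ᵉ) Γ ⊢ φ [ σ ]ᵉ)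
    assumption   : ∀ {Γ φ} → φ ∈ Γ → Derivable (Γ ⊢ φ)
    cut          : ∀ {Γ Θ ψ} → (∀ φ → φ ∈ Θ → Derivable (Γ ⊢ φ)) → Derivable (Θ ⊢ ψ) → Derivable (Γ ⊢ ψ)

  generated : Theory S
  generated = record { Member = Derivable ; isTheory = record
    { ≐-refl = ≐-refl ; ≐-sym = ≐-sym ; ≐-triangle = ≐-triangle ; ≐-weaken = ≐-weaken ; ≐-nonexp = ≐-nonexp
    ; continuity = continuity ; substitution = substitution ; assumption = assumption ; cut = cut } }

  generated-smallest : ∀ {U} → IsTheory U → A ⊆ U → Derivable ⊆ U
  generated-smallest {U} th A⊆U _ = go
    where
    module U = IsTheory th
    go : ∀ {φ} → Derivable φ → U φ
    go (axiom a)              = A⊆U _ a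
    go (≐-refl x)             = U.≐-refl x
    go (≐-sym x y ε)          = U.≐-sym x y ε
    go (≐-triangle x y z ε δ) = U.≐-triangle x y z ε δ
    go (≐-weaken x y ε δ p)   = U.≐-weaken x y ε δ p
    go (≐-nonexp f x y ε)     = U.≐-nonexp f x y ε
    go (continuity f)         = U.continuity λ ε′ p → go (f ε′ p)
    go (substitution σ p)     = U.substitution σ (go p)
    go (assumption p)         = U.assumption p
    go (cut f p)              = U.cut (λ φ q → go (f φ q)) (go p)

  generated-axiomatizes : A Axiomatizes generated
  generated-axiomatizes = record
    { contained = λ _ → axiom ; smallest = λ U′ → generated-smallest (isTheory U′) }

record ContinuousSchema (S : Signature) : Set₁ where
  field
    {arity}    : ℕ
    x y        : Fin arity → Var
    t s        : Term S Var
    f          : (Fin arity → ℝ≥0) → ℝ≥0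
    continuous : IsContinuous f

data Instance {S : Signature} (σ : ContinuousSchema S) : CondQEq S → Set where
  inst : let open ContinuousSchema σ in
         ∀ (e : Fin arity → ℚ≥0) (ε : ℚ≥0) → real (f (λ i → ι (e i))) ⊑ ε →
         Instance σ (tabulate (λ i → var (x i) ≐[ e i ] var (y i)) ⊢ t ≐[ ε ] s)

record Continuous {S : Signature} (U : Theory S) : Set₁ where
  field
    Index        : Set
    schema       : Index → ContinuousSchema S
    axiomatizes  : (λ φ → ∃[ i ] Instance (schema i) φ) Axiomatizes U

record QAlg (S : Signature) : Set₁ where
  field
    met : Met
    ops : (f : Op S) → NonExpansive (Power (ar S f) met) met

  ⟦_⟧ : ∀ {V} → Term S V → (V → ∣ met ∣) → ∣ met ∣
  ⟦ t ⟧ ρ = eval (λ f → fun (ops f)) ρ t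

  op-cong : ∀ f {x y} → (∀ i → Met._≈_ met (x i) (y i)) → Met._≈_ met (fun (ops f) x) (fun (ops f) y)
  op-cong f p = resp (ops f) (λ i → Met.≈⇒ball met (p i))

  ⟦⟧-cong : ∀ {V} {ρ ρ′ : V → ∣ met ∣} → (∀ v → Met._≈_ met (ρ v) (ρ′ v)) →
            ∀ t → Met._≈_ met (⟦ t ⟧ ρ) (⟦ t ⟧ ρ′)
  ⟦⟧-cong p (var v)  = p v
  ⟦⟧-cong p (op f t) = op-cong f λ i → ⟦⟧-cong p (t i)

  ⟦⟧-subst : ∀ {V W} (σ : V → Term S W) (ρ : W → ∣ met ∣) t →
             Met._≈_ met (⟦ t [ σ ] ⟧ ρ) (⟦ t ⟧ (λ v → ⟦ σ v ⟧ ρ))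
  ⟦⟧-subst σ ρ (var v)  = Met.≈-refl met
  ⟦⟧-subst σ ρ (op f t) = op-cong f λ i → ⟦⟧-subst σ ρ (t i)

module _ {S : Signature} (A : QAlg S) where
  open QAlg A
  private module A = Met met

  Holds : (Var → ∣ met ∣) → QEq S → Set
  Holds ρ (t ≐[ ε ] s) = A.d (⟦ t ⟧ ρ) (⟦ s ⟧ ρ) ⊑ ε

  Satisfies : CondQEq S → Set
  Satisfies (Γ ⊢ φ) = ∀ ρ → (∀ ψ → ψ ∈ Γ → Holds ρ ψ) → Holds ρ φ

  Holds-subst : ∀ σ ρ φ → Holds ρ (φ [ σ ]ᵉ) ⇔ Holds (λ v → ⟦ σ v ⟧ ρ) φ
  Holds-subst σ ρ (t ≐[ ε ] s) = mk⇔
    (A.ball-resp (⟦⟧-subst σ ρ t) (⟦⟧-subst σ ρ s))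
    (A.ball-resp (A.≈-sym (⟦⟧-subst σ ρ t)) (A.≈-sym (⟦⟧-subst σ ρ s)))

  Satisfies-isTheory : IsTheory Satisfies
  Satisfies-isTheory = record
    { ≐-refl       = λ x ρ _ → A.≈⇒ball A.≈-refl
    ; ≐-sym        = λ x y ε ρ p → A.ball-sym (p _ (here refl))
    ; ≐-triangle   = λ x y z ε ε′ ρ p → A.ball-tri (p _ (here refl)) (p _ (there (here refl)))
    ; ≐-weaken     = λ x y ε ε′ _ ρ p → ⊑-upper (A.d (ρ x) (ρ y)) p≤p+q (p _ (here refl))
    ; ≐-nonexp     = λ f x y ε ρ p → nonexp (ops f) _ _ ε λ i → p _ (∈-tabulate⁺ i)
    ; continuity   = λ f ρ p → ⊑-closed (A.d _ _) λ h h>0 → f _ (p<p+q h>0) ρ p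
    ; substitution = λ {Γ} {φ} σ p ρ q → Equivalence.from (Holds-subst σ ρ φ)
                       (p _ λ ψ m → Equivalence.to (Holds-subst σ ρ ψ) (q _ (∈-map⁺ (_[ σ ]ᵉ) m)))
    ; assumption   = λ m ρ p → p _ m
    ; cut          = λ f p ρ q → p ρ λ φ m → f φ m ρ q
    }

infix 4 _⊨_
_⊨_ : ∀ {S} → QAlg S → Theory S → Set
A ⊨ U = Member U ⊆ Satisfies A

record Model {S : Signature} (U : Theory S) : Set₁ where
  field
    alg       : QAlg S
    complete  : Complete (QAlg.met alg)
    satisfies : alg ⊨ U
  open QAlg alg public

record Hom {S : Signature} (A B : QAlg S) : Set where
  private
    module A = QAlg A
    module B = QAlg B
  field
    hom       : NonExpansive A.met B.met
    preserves : ∀ f x → Met._≈_ B.met (fun hom (fun (A.ops f) x)) (fun (B.ops f) (λ i → fun hom (x i)))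

ℂ𝕂 : (S : Signature) → Theory S → Category (lsuc 0ℓ) 0ℓ 0ℓ
ℂ𝕂 S U = record
  { Obj       = Model U
  ; _⇒_       = λ A B → Hom (Model.alg A) (Model.alg B)
  ; _≈_       = λ {A} {B} f g → ∀ x → Met._≈_ (Model.met B) (fun (Hom.hom f) x) (fun (Hom.hom g) x)
  ; id        = λ {A} → record { hom = idNE ; preserves = λ f x → Met.≈-refl (Model.met A) }
  ; _∘_       = λ {A} {B} {D} g f → record
    { hom       = Hom.hom g ∘NE Hom.hom f
    ; preserves = λ o x → Met.≈-trans (Model.met D) (resp (Hom.hom g) (Hom.preserves f o x)) (Hom.preserves g o _)
    }
  ; equiv     = λ {A} {B} → record
    { refl  = λ x → Met.≈-refl (Model.met B)
    ; sym   = λ p x → Met.≈-sym (Model.met B) (p x)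
    ; trans = λ p q x → Met.≈-trans (Model.met B) (p x) (q x) }
  ; ∘-resp-≈  = λ {_} {_} {D} {f} p q x → Met.≈-trans (Model.met D) (resp (Hom.hom f) (q x)) (p _)
  ; assoc     = λ {_} {_} {_} {D} x → Met.≈-refl (Model.met D)
  ; identityˡ = λ {_} {B} x → Met.≈-refl (Model.met B)
  ; identityʳ = λ {_} {B} x → Met.≈-refl (Model.met B)
  }

forget : ∀ {S} (U : Theory S) → Functor (ℂ𝕂 S U) CMET
forget U = record
  { F₀           = λ A → Model.met A , Model.complete A
  ; F₁           = Hom.hom
  ; identity     = λ {A} x → Met.≈-refl (Model.met A)
  ; homomorphism = λ {_} {_} {D} x → Met.≈-refl (Model.met D)
  ; F-resp-≈     = λ p → p
  }

completionAlg : ∀ {S} → QAlg S → QAlg S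
completionAlg {S} A = record { met = Completion met ; ops = opsᶜ }
  where
  open QAlg A
  opsᶜ : (f : Op S) → NonExpansive (Power (ar S f) (Completion met)) (Completion met)
  opsᶜ f = ne
    (λ x → (λ n → fun (ops f) (λ i → seq (x i) n)) ,
           map-Cauchy (ops f) (Power-Cauchy (ar S f) met (λ i → cauchy (x i))))
    λ x y r p h h>0 → let N = λ i → proj₁ (p i h h>0) in maximum N , λ n a →
      nonexp (ops f) _ _ _ λ i → proj₂ (p i h h>0) n (ℕ.≤-trans (≤-maximum N i) a)

module _ {S : Signature} (A : QAlg S) where
  private
    open QAlg A
    module A = Met met
    module Aᶜ = QAlg (completionAlg A)

  seq-⟦⟧ : ∀ {V} (ρ : V → Fundamental met) t n →
           seq (Aᶜ.⟦ t ⟧ ρ) n A.≈ ⟦ t ⟧ (λ v → seq (ρ v) n)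
  seq-⟦⟧ ρ (var v)  n = A.≈-refl
  seq-⟦⟧ ρ (op f t) n = op-cong f λ i → seq-⟦⟧ ρ (t i) n

  eventually⇒Holds : ∀ {ρ} φ → (∀ h → 0# < h → ∃[ N ] (∀ n → N ℕ.≤ n →
                       Holds A (λ v → seq (ρ v) n) (lhs φ ≐[ ε φ + h ] rhs φ))) →
                     Holds (completionAlg A) ρ φ
  eventually⇒Holds {ρ} (t ≐[ ε ] s) f h h>0 = let (N , p) = f h h>0 in N , λ n a →
    A.ball-resp (A.≈-sym (seq-⟦⟧ ρ t n)) (A.≈-sym (seq-⟦⟧ ρ s n)) (p n a)

-- What the construction of the free complete model needs of U; continuous theories have it,
-- and so do the sums used below.
ClosedUnderCompletion : ∀ {S} → Theory S → Set₁
ClosedUnderCompletion {S} U = ∀ (A : QAlg S) → A ⊨ U → completionAlg A ⊨ U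

⊨-axioms : ∀ {S} {A : CondQEq S → Set} {U : Theory S} → A Axiomatizes U →
           ∀ (B : QAlg S) → A ⊆ Satisfies B → B ⊨ U
⊨-axioms ax B = _Axiomatizes_.smallest ax (record { Member = Satisfies B ; isTheory = Satisfies-isTheory B })

ι-near : ∀ p δ → ι p ∼⟨ δ ⟩ ι (p + δ)
ι-near p δ =
  (λ q f → ⊑-closed ⌊ p ⌋ λ h h>0 → let (a , b , p+δ≤a , _ , le) = f h h>0 in
    ≤-trans p≤p+q (≤-trans p+δ≤a (≤-trans p≤p+q le))) ,
  (λ q f → ⊑-closed ⌊ p + δ ⌋ λ h h>0 → let (a , b , p≤a , δ≤b , le) = f h h>0 in
    ≤-trans (+-mono-≤ p≤a δ≤b) le)

continuous⇒closed : ∀ {S} {U : Theory S} → Continuous U → ClosedUnderCompletion U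
continuous⇒closed {S} {U} cont A A⊨U = ⊨-axioms axiomatizes (completionAlg A) λ _ (i , a) →
  sat (schema i) (λ φ b → A⊨U φ (contained φ (i , b))) _ a
  where
  open Continuous cont
  open _Axiomatizes_ axiomatizes
  sat : ∀ σ → Instance σ ⊆ Satisfies A → Instance σ ⊆ Satisfies (completionAlg A)
  sat σ A⊨σ _ (inst e ε fe≤ε) ρ p = eventually⇒Holds A (t ≐[ ε ] s) go
    where
    open ContinuousSchema σ
    hyp : (Fin arity → ℚ≥0) → Fin arity → QEq S
    hyp e i = var (x i) ≐[ e i ] var (y i)
    go : ∀ h → 0# < h → ∃[ N ] (∀ n → N ℕ.≤ n → Holds A (λ v → seq (ρ v) n) (t ≐[ ε + h ] s))
    go h h>0 with continuous (λ i → ι (e i)) h h>0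
    ... | δ , δ>0 , near = maximum N , λ n a →
      A⊨σ _ (inst (λ i → e i + δ) (ε + h) (bound (ε + h) (+∞-⊑ (real (f (λ i → ι (e i)))) ⌊ h ⌋ fe≤ε ≤-refl)))
        (λ v → seq (ρ v) n) (premises n a)
      where
      within : ∀ i → ∃[ N ] (∀ n → N ℕ.≤ n → Holds A (λ v → seq (ρ v) n) (hyp (λ i → e i + δ) i))
      within i = p (hyp e i) (∈-tabulate⁺ i) δ δ>0
      N : Fin arity → ℕ
      N i = proj₁ (within i)
      bound : real (f (λ i → ι (e i + δ))) ≤∞ real (f (λ i → ι (e i))) +∞ ⌊ h ⌋
      bound = proj₂ (near (λ i → ι (e i + δ)) λ i → ι-near (e i) δ)
      premises : ∀ n → maximum N ℕ.≤ n → ∀ ψ → ψ ∈ tabulate (hyp (λ i → e i + δ)) → Holds A (λ v → seq (ρ v) n) ψ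
      premises n a ψ m with ∈-tabulate⁻ m
      ... | i , refl = proj₂ (within i) n (ℕ.≤-trans (≤-maximum N i) a)

module FreeAlgebra {S : Signature} (U : Theory S) (X : Met) where
  private module X = Met X

  -- d(t,s) ≤ r iff t =ᵣ s is derivable from U and the distances of X
  data _∼[_]_ : Term S ∣ X ∣ → ℚ≥0 → Term S ∣ X ∣ → Set where
    generator : ∀ {x y r} → X.d x y ⊑ r → var x ∼[ r ] var y
    instantiate : ∀ {Γ t ε s} → Member U (Γ ⊢ t ≐[ ε ] s) → (σ : Var → Term S ∣ X ∣) →
                  (∀ ψ → ψ ∈ Γ → (lhs ψ [ σ ]) ∼[ QEq.ε ψ ] (rhs ψ [ σ ])) → (t [ σ ]) ∼[ ε ] (s [ σ ])
    ∼-refl    : ∀ {t} → t ∼[ 0# ] t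
    ∼-sym     : ∀ {t s r} → t ∼[ r ] s → s ∼[ r ] t
    ∼-tri     : ∀ {t s u p q} → t ∼[ p ] s → s ∼[ q ] u → t ∼[ p + q ] u
    ∼-upper   : ∀ {t s p q} → p ≤ q → t ∼[ p ] s → t ∼[ q ] s
    ∼-closed  : ∀ {t s q} → (∀ h → 0# < h → t ∼[ q + h ] s) → t ∼[ q ] s
    ∼-op      : ∀ f {t s r} → (∀ i → t i ∼[ r ] s i) → op f t ∼[ r ] op f s

  freeMet : Met
  freeMet = FromBalls.met (Term S ∣ X ∣) _∼[_]_ ∼-upper ∼-closed ∼-refl ∼-sym ∼-tri

  freeAlg : QAlg S
  freeAlg = record { met = freeMet ; ops = λ f → ne (op f) λ _ _ _ → ∼-op f }

  freeAlg⊨U : freeAlg ⊨ U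
  freeAlg⊨U (Γ ⊢ t ≐[ ε ] s) φ∈U ρ p = instantiate φ∈U ρ p

  module _ (B : QAlg S) (B⊨U : B ⊨ U) (h : NonExpansive X (QAlg.met B)) where
    private
      module B = QAlg B
      module BM = Met B.met

    interpret : Term S ∣ X ∣ → ∣ B.met ∣
    interpret t = B.⟦ t ⟧ (fun h)

    interpret-nonexp : ∀ {t r s} → t ∼[ r ] s → BM.d (interpret t) (interpret s) ⊑ r
    interpret-nonexp (generator {x} {y} {r} p) = nonexp h x y r p
    interpret-nonexp (instantiate {Γ} {t} {ε} {s} φ∈U σ p) =
      BM.ball-resp (BM.≈-sym (B.⟦⟧-subst σ (fun h) t)) (BM.≈-sym (B.⟦⟧-subst σ (fun h) s))
        (B⊨U _ φ∈U (λ v → interpret (σ v)) λ ψ m →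
          BM.ball-resp (B.⟦⟧-subst σ (fun h) (lhs ψ)) (B.⟦⟧-subst σ (fun h) (rhs ψ)) (interpret-nonexp (p ψ m)))
    interpret-nonexp ∼-refl          = BM.≈⇒ball BM.≈-refl
    interpret-nonexp (∼-sym p)       = BM.ball-sym (interpret-nonexp p)
    interpret-nonexp (∼-tri p q)     = BM.ball-tri (interpret-nonexp p) (interpret-nonexp q)
    interpret-nonexp (∼-upper {t} {s} le p) = ⊑-upper (BM.d (interpret t) (interpret s)) le (interpret-nonexp p)
    interpret-nonexp (∼-closed {t} {s} f) = ⊑-closed (BM.d (interpret t) (interpret s)) λ k k>0 → interpret-nonexp (f k k>0)
    interpret-nonexp (∼-op f p)      = nonexp (B.ops f) _ _ _ λ i → interpret-nonexp (p i)

    interpretNE : NonExpansive freeMet B.met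
    interpretNE = ne interpret λ _ _ _ → interpret-nonexp

-- The left adjoint sends X to the Cauchy completion of the free quantitative algebra on X.
module _ {S : Signature} (U : Theory S) (closed : ClosedUnderCompletion U) where

  freeModel : CMet → Model U
  freeModel X = record
    { alg       = completionAlg freeAlg
    ; complete  = Completion-complete freeMet
    ; satisfies = closed freeAlg freeAlg⊨U
    }
    where open FreeAlgebra U (space X)

  forget-leftAdjoint : LeftAdjoint (forget U)
  forget-leftAdjoint = record
    { Free        = freeModel
    ; unit        = λ X → unitNE (space X)
    ; extend      = λ {X} {B} h → ext (space X) B h
    ; extend-∘    = λ {X} {B} h → ext-unit (space X) B h
    ; extend-uniq = λ {X} {B} {h} g p → ext-unique (space X) B h g p
    }
    where
    open FreeAlgebra U

    unitNE : ∀ X → NonExpansive X (Completion (freeMet X))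
    unitNE X = embed (freeMet X) ∘NE ne var (λ _ _ _ p → generator p)

    module _ (X : Met) (B : Model U) (h : NonExpansive X (Model.met B)) where
      private
        module B = Model B
        module BM = Met B.met
        F = freeMet X
        F̄ = completionAlg (freeAlg X)
        int = interpretNE X B.alg B.satisfies h

      extNE : NonExpansive (Completion F) B.met
      extNE = extendCompletion int B.complete

      ext-lim : ∀ s → Converges B.met (λ n → fun int (seq s n)) (fun extNE s)
      ext-lim = extendCompletion-lim int B.complete

      ext : Hom F̄ B.alg
      ext = record
        { hom       = extNE
        ; preserves = λ f x → Limits.limit-unique B.met (ext-lim (fun (QAlg.ops F̄ f) x))
            (map-Converges (B.ops f) (Power-Converges (ar S f) B.met λ i → ext-lim (x i)))
        }

      ext-unit : ∀ x → fun extNE (fun (unitNE X) x) BM.≈ fun h x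
      ext-unit x = Limits.limit-unique B.met (ext-lim (fun (unitNE X) x))
        (λ ε _ → 0 , λ _ _ → BM.≈⇒ball BM.≈-refl)

      ext-unique : (g : Hom F̄ B.alg) → (∀ x → fun (Hom.hom g) (fun (unitNE X) x) BM.≈ fun h x) →
                   ∀ s → fun (Hom.hom g) s BM.≈ fun extNE s
      ext-unique g p s = Limits.limit-unique B.met
        (Limits.limit-resp B.met (λ n → on-terms (seq s n)) (map-Converges (Hom.hom g) (embed-dense F s)))
        (ext-lim s)
        where
        on-terms : ∀ t → fun (Hom.hom g) (fun (embed F) t) BM.≈ fun int t
        on-terms (var x)  = p x
        on-terms (op f t) = BM.≈-trans (resp (Hom.hom g) (pointwise-≈ F
            {fun (embed F) (op f t)} {fun (QAlg.ops F̄ f) (λ i → fun (embed F) (t i))} λ _ → Met.≈-refl F))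
          (BM.≈-trans (Hom.preserves g f (λ i → fun (embed F) (t i))) (B.op-cong f λ i → on-terms (t i)))

  ℂT : Monad CMET
  ℂT = inducedMonad forget-leftAdjoint

module _ (T : Signature) {O : Set} (j : O → Op T) where

  pullback : Signature
  pullback = record { Op = O ; ar = λ f → ar T (j f) }

  translate : ∀ {V} → Term pullback V → Term T V
  translate (var x)  = var x
  translate (op f t) = op (j f) (λ i → translate (t i))

  translateᵉ : QEq pullback → QEq T
  translateᵉ (t ≐[ ε ] s) = translate t ≐[ ε ] translate s

  data Image (U : Theory pullback) : CondQEq T → Set where
    image : ∀ {Γ φ} → Member U (Γ ⊢ φ) → Image U (map translateᵉ Γ ⊢ translateᵉ φ)

  reduct : QAlg T → QAlg pullback
  reduct A = record { met = QAlg.met A ; ops = λ f → QAlg.ops A (j f) }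

  module _ (A : QAlg T) where
    private
      module A = QAlg A
      module AM = Met A.met

    ⟦⟧-translate : ∀ {V} (t : Term pullback V) ρ → A.⟦ translate t ⟧ ρ AM.≈ QAlg.⟦_⟧ (reduct A) t ρ
    ⟦⟧-translate (var x)  ρ = AM.≈-refl
    ⟦⟧-translate (op f t) ρ = A.op-cong (j f) λ i → ⟦⟧-translate (t i) ρ

    Holds-translate : ∀ ρ φ → Holds A ρ (translateᵉ φ) ⇔ Holds (reduct A) ρ φ
    Holds-translate ρ (t ≐[ ε ] s) = mk⇔
      (AM.ball-resp (⟦⟧-translate t ρ) (⟦⟧-translate s ρ))
      (AM.ball-resp (AM.≈-sym (⟦⟧-translate t ρ)) (AM.≈-sym (⟦⟧-translate s ρ)))

    Image⇔reduct : (U : Theory pullback) → Image U ⊆ Satisfies A ⇔ reduct A ⊨ U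
    Image⇔reduct U = mk⇔
      (λ p (Γ ⊢ φ) m ρ q → Equivalence.to (Holds-translate ρ φ) (p _ (image m) ρ λ ψ n →
        let (χ , n′ , eq) = ∈-map⁻ translateᵉ n in
        subst (Holds A ρ) (sym eq) (Equivalence.from (Holds-translate ρ χ) (q χ n′))))
      (λ { p _ (image {Γ} {φ} m) ρ q → Equivalence.from (Holds-translate ρ φ) (p _ m ρ λ ψ n →
        Equivalence.to (Holds-translate ρ ψ) (q _ (∈-map⁺ translateᵉ n))) })

infixr 6 _⊎ˢ_ _⊕_

-- Disjointness of the two types is enforced by tagging the operation symbols.
_⊎ˢ_ : Signature → Signature → Signature
S ⊎ˢ T = record { Op = Op S ⊎ Op T ; ar = [ ar S , ar T ]′ }

SumAxioms : ∀ {S T} → Theory S → Theory T → CondQEq (S ⊎ˢ T) → Set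
SumAxioms {S} {T} U U′ φ = Image (S ⊎ˢ T) inj₁ U φ ⊎ Image (S ⊎ˢ T) inj₂ U′ φ

_⊕_ : ∀ {S T} → Theory S → Theory T → Theory (S ⊎ˢ T)
U ⊕ U′ = generated (SumAxioms U U′)

⊕-closed : ∀ {S T} (U : Theory S) (U′ : Theory T) →
           ClosedUnderCompletion U → ClosedUnderCompletion U′ → ClosedUnderCompletion (U ⊕ U′)
⊕-closed {S} {T} U U′ cl cl′ A A⊨ = ⊨-axioms (generated-axiomatizes (SumAxioms U U′)) (completionAlg A) λ where
    φ (inj₁ m) → Equivalence.from (Image⇔reduct (S ⊎ˢ T) inj₁ (completionAlg A) U)
      (cl (reduct (S ⊎ˢ T) inj₁ A)
        (Equivalence.to (Image⇔reduct (S ⊎ˢ T) inj₁ A U) λ ψ n → A⊨ ψ (axiom (inj₁ n)))) φ m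
    φ (inj₂ m) → Equivalence.from (Image⇔reduct (S ⊎ˢ T) inj₂ (completionAlg A) U′)
      (cl′ (reduct (S ⊎ˢ T) inj₂ A)
        (Equivalence.to (Image⇔reduct (S ⊎ˢ T) inj₂ A U′) λ ψ n → A⊨ ψ (axiom (inj₂ n)))) φ m

record ContractiveSignature : Set₁ where
  field
    signature : Signature
    countable : Op signature ↣ ℕ
    factor    : Op signature → ℝ≥0
    0<factor  : ∀ f → 0∞ <∞ real (factor f)
    factor<1  : ∀ f → real (factor f) <∞ 1∞

module _ (C : ContractiveSignature) where
  open ContractiveSignature C

  data ContractiveAxiom : CondQEq signature → Set where
    contractive : ∀ f (x y : Fin (ar signature f) → Var) ε δ → real (factor f) *∞ ⌊ ε ⌋ ⊑ δ →
                  ContractiveAxiom (tabulate (λ i → var (x i) ≐[ ε ] var (y i)) ⊢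
                                    op f (λ i → var (x i)) ≐[ δ ] op f (λ i → var (y i)))

  𝒪 : Theory signature
  𝒪 = generated ContractiveAxiom

  private
    slack : ∀ f ε δ h → 0# < h → real (factor f) *∞ ⌊ ε ⌋ ⊑ δ → real (factor f) *∞ ⌊ ε + h ⌋ ⊑ δ + h
    slack f ε δ h _ p k k>0 = go (p k k>0)
      where
      c = real (factor f)
      regroup : δ + k + h ≤ δ + h + k
      regroup = ≤-reflexive (trans (+-assoc δ k h) (trans (cong (δ +_) (+-comm k h)) (sym (+-assoc δ h k))))
      finish : ∀ {a} → a ≤ 1# → a * ε ≤ δ + k → a * (ε + h) ≤ δ + h + k
      finish {a} a≤1 le = ≤-trans (≤-reflexive (*-distribˡ-+ a ε h))
        (≤-trans (+-mono-≤ le (≤-trans (*-mono-≤ a≤1 ≤-refl) (≤-reflexive (*-identityˡ h)))) regroup)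
      go : (∃₂ λ a e → c ⊑ a × ⌊ ε ⌋ ⊑ e × a * e ≤ δ + k) →
           ∃₂ λ a e → c ⊑ a × ⌊ ε + h ⌋ ⊑ e × a * e ≤ δ + h + k
      go (a , e , ca , ε≤e , le) with ≤-total a 1#
      ... | inj₁ a≤1 = a , ε + h , ca , ≤-refl , finish a≤1 (≤-trans (*-mono-≤ ≤-refl ε≤e) le)
      ... | inj₂ 1≤a = 1# , ε + h , ⊑-1 {c} (factor<1 f) , ≤-refl ,
                       finish ≤-refl (≤-trans (*-mono-≤ 1≤a ε≤e) le)

  𝒪-closed : ClosedUnderCompletion 𝒪
  𝒪-closed A A⊨ = ⊨-axioms (generated-axiomatizes ContractiveAxiom) (completionAlg A)
    λ { _ (contractive f x y ε δ cε≤δ) → sat f x y ε δ cε≤δ }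
    where
    sat : ∀ f x y ε δ → real (factor f) *∞ ⌊ ε ⌋ ⊑ δ →
          Satisfies (completionAlg A) (tabulate (λ i → var (x i) ≐[ ε ] var (y i)) ⊢
                                       op f (λ i → var (x i)) ≐[ δ ] op f (λ i → var (y i)))
    sat f x y ε δ cε≤δ ρ p = eventually⇒Holds A {ρ} (op f (λ i → var (x i)) ≐[ δ ] op f (λ i → var (y i))) λ h h>0 →
      maximum (N h h>0) , λ n a →
        A⊨ _ (axiom (contractive f x y (ε + h) (δ + h) (slack f ε δ h h>0 cε≤δ))) (λ v → seq (ρ v) n) (premises h h>0 n a)
      where
      hyp : ℚ≥0 → Fin (ar signature f) → QEq signature
      hyp e i = var (x i) ≐[ e ] var (y i)
      within : ∀ h → 0# < h → ∀ i → ∃[ N ] (∀ n → N ℕ.≤ n → Holds A (λ v → seq (ρ v) n) (hyp (ε + h) i))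
      within h h>0 i = p (hyp ε i) (∈-tabulate⁺ i) h h>0
      N : ∀ h → 0# < h → Fin (ar signature f) → ℕ
      N h h>0 i = proj₁ (within h h>0 i)
      premises : ∀ h h>0 n → maximum (N h h>0) ℕ.≤ n → ∀ ψ → ψ ∈ tabulate (hyp (ε + h)) →
                 Holds A (λ v → seq (ρ v) n) ψ
      premises h h>0 n a ψ m with ∈-tabulate⁻ m
      ... | i , refl = proj₂ (within h h>0 i) n (ℕ.≤-trans (≤-maximum (N h h>0) i) a)

  summand : Met → Op signature → Met
  summand X f = Scale (factor f) (Power (ar signature f) X)

  Σ̃-map : ∀ {X Y} → NonExpansive X Y → NonExpansive (Sum _ (summand X)) (Sum _ (summand Y))
  Σ̃-map g = ne (λ (f , x) → f , λ i → fun g (x i)) λ { _ _ _ (same p) → same λ h h>0 →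
    let (a , q , ca , d , le) = p h h>0 in a , q , ca , (λ i → nonexp g _ _ q (d i)) , le }

  -- Σ̃ X = ∐_f factor f · X^(ar f)
  Σ̃ : Functor CMET CMET
  Σ̃ = record
    { F₀           = λ X → Sum (Op signature) (summand (space X)) ,
                       Sum-complete _ (summand (space X)) λ f →
                         Scale-complete (factor f) (0<factor f) (Power (ar signature f) (space X)) (factor<1 f)
                           (Power-complete (ar signature f) (space X) (complete X))
    ; F₁           = Σ̃-map
    ; identity     = λ {A} _ → Met.≈-refl (Sum _ (summand (space A)))
    ; homomorphism = λ {_} {_} {E} _ → Met.≈-refl (Sum _ (summand (space E)))
    ; F-resp-≈     = λ {_} {B} p (f , x) → same (Scale-≈ (factor f) (Power (ar signature f) (space B))
                       λ i → Met.≈⇒ball (space B) (p (x i)))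
    }

{-# OPTIONS --safe #-}
module Submission where

open import Data.Product.Base using (_×_; Σ-syntax)
open import Defs

open import Data.Fin.Base using (Fin; toℕ; fromℕ<; _↑ˡ_; _↑ʳ_; splitAt)
open import Data.Fin.Properties using (toℕ<n; fromℕ<-toℕ; splitAt-↑ˡ; splitAt-↑ʳ)
open import Data.List.Membership.Propositional.Properties using (∈-tabulate⁺; ∈-tabulate⁻)
open import Data.Nat.Base using () renaming (_+_ to _+ᴺ_)
open import Data.Nat.Properties using (_<?_)
open import Data.Product.Base using (_,_; ∃-syntax)
open import Data.Sum.Base using (inj₁; inj₂; [_,_]′)
open import Function.Bundles using (module Equivalence)
open import Level using (_⊔_)
open import Relation.Binary.Bundles using (Setoid)
open import Relation.Binary.PropositionalEquality using (_≡_; refl; sym; trans; cong; subst; subst₂)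
import Relation.Binary.Reasoning.Setoid as SetoidReasoning
open import Relation.Nullary using (yes; no; contradiction)

-- A model of U + 𝒪 is the same thing as a model of U with a Σ̃-algebra structure on its carrier, so the free complete
-- model A of U + 𝒪 on X is the free such bialgebra on X. It is an initial algebra for T (Σ̃ - + X): given
-- h : T (Σ̃ B + X) → B, the free T-algebra T (Σ̃ B + X) becomes a bialgebra under X by letting Σ̃ act through h, and
-- following the induced map A → T (Σ̃ B + X) by h gives the fold of h. Conversely, for any choice of initial algebras
-- R X is the free bialgebra on X among Eilenberg–Moore algebras with an F-action, so every equation between maps out of
-- R X, in particular the monad laws and the compatibility with the multiplications, can be checked on generators.

-- Equational reasoning in hom-sets, and binary coproducts.

module HomReasoning {o ℓ e} (C : Category o ℓ e) where
  open Category C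

  homSetoid : Obj → Obj → Setoid ℓ e
  homSetoid A B = record { Carrier = A ⇒ B ; _≈_ = _≈_ ; isEquivalence = equiv }

  module _ {A B : Obj} where
    open SetoidReasoning (homSetoid A B) public

  module _ {A B D} {f : B ⇒ D} {g : A ⇒ B} {h : A ⇒ D} (p : f ∘ g ≈ h) where
    pullˡ : ∀ {Z} {k : Z ⇒ A} → f ∘ g ∘ k ≈ h ∘ k
    pullˡ = ≈-trans (≈-sym assoc) (p ⟩∘ _)

    pullʳ : ∀ {Z} {k : D ⇒ Z} → (k ∘ f) ∘ g ≈ k ∘ h
    pullʳ = ≈-trans assoc (_ ∘⟨ p)

  swapˡ : ∀ {A B B′ D Z} {f : B ⇒ D} {g : A ⇒ B} {f′ : B′ ⇒ D} {g′ : A ⇒ B′} {k : Z ⇒ A} →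
          f ∘ g ≈ f′ ∘ g′ → f ∘ g ∘ k ≈ f′ ∘ g′ ∘ k
  swapˡ p = ≈-trans (pullˡ p) assoc

  cancelˡ : ∀ {A B Z} {f : B ⇒ A} {g : A ⇒ B} {k : Z ⇒ A} → f ∘ g ≈ id → f ∘ g ∘ k ≈ k
  cancelˡ p = ≈-trans (pullˡ p) identityˡ

module CoproductProperties {o ℓ e} {C : Category o ℓ e} (coproducts : BinaryCoproducts C) where
  open Category C
  open HomReasoning C
  open BinaryCoproducts coproducts renaming ([_,_] to ⁅_,_⁆)

  copair-unique₂ : ∀ {A B D} {h k : A ∐ B ⇒ D} → h ∘ inl ≈ k ∘ inl → h ∘ inr ≈ k ∘ inr → h ≈ k
  copair-unique₂ p q = ≈-trans (≈-sym (unique p q)) (unique ≈-refl ≈-refl)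

  copair-∐₁ : ∀ {A A′ B B′ D} {f : A′ ⇒ D} {g : B′ ⇒ D} {h : A ⇒ A′} {k : B ⇒ B′} →
              ⁅ f , g ⁆ ∘ (h ∐₁ k) ≈ ⁅ f ∘ h , g ∘ k ⁆
  copair-∐₁ = ≈-sym (unique
    (≈-trans (pullʳ inject₁) (pullˡ inject₁))
    (≈-trans (pullʳ inject₂) (pullˡ inject₂)))

  copair-resp-≈ : ∀ {A B D} {f f′ : A ⇒ D} {g g′ : B ⇒ D} → f ≈ f′ → g ≈ g′ → ⁅ f , g ⁆ ≈ ⁅ f′ , g′ ⁆
  copair-resp-≈ p q = unique (≈-trans inject₁ (≈-sym p)) (≈-trans inject₂ (≈-sym q))

-- Eilenberg-Moore algebras with an `F`-action, and the canonical monad on resumptions.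

module Bialgebras {o ℓ e} {C : Category o ℓ e} (coproducts : BinaryCoproducts C)
                  (T : Monad C) (F : Functor C C) where
  open Category C
  open HomReasoning C
  open BinaryCoproducts coproducts renaming ([_,_] to ⁅_,_⁆)
  open CoproductProperties coproducts
  open Monad T
  open Functor F using (F₀; F₁; identity; homomorphism; F-resp-≈)
  open Resumption coproducts T F

  record Bialgebra : Set (o ⊔ ℓ ⊔ e) where
    field
      carrier  : Obj
      T-act    : T₀ carrier ⇒ carrier
      act-unit : T-act ∘ η carrier ≈ id
      act-mult : T-act ∘ T₁ T-act ≈ T-act ∘ μ carrier
      F-act    : F₀ carrier ⇒ carrier

  open Bialgebra

  record IsHom (A B : Bialgebra) (h : carrier A ⇒ carrier B) : Set e where
    field
      T-hom : h ∘ T-act A ≈ T-act B ∘ T₁ h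
      F-hom : h ∘ F-act A ≈ F-act B ∘ F₁ h

  open IsHom

  IsHom-resp-≈ : ∀ {A B h k} → h ≈ k → IsHom A B h → IsHom A B k
  IsHom-resp-≈ e p .T-hom = ≈-trans (≈-sym e ⟩∘ _) (≈-trans (T-hom p) (_ ∘⟨ T-resp-≈ e))
  IsHom-resp-≈ e p .F-hom = ≈-trans (≈-sym e ⟩∘ _) (≈-trans (F-hom p) (_ ∘⟨ F-resp-≈ e))

  id-isHom : ∀ {A} → IsHom A A id
  id-isHom .T-hom = ≈-trans identityˡ (≈-sym (≈-trans (_ ∘⟨ T-identity) identityʳ))
  id-isHom .F-hom = ≈-trans identityˡ (≈-sym (≈-trans (_ ∘⟨ identity) identityʳ))

  ∘-isHom : ∀ {A B D h k} → IsHom B D k → IsHom A B h → IsHom A D (k ∘ h)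
  ∘-isHom {A} {B} {D} {h} {k} p q .T-hom = begin
    (k ∘ h) ∘ T-act A         ≈⟨ pullʳ (T-hom q) ⟩
    k ∘ T-act B ∘ T₁ h        ≈⟨ pullˡ (T-hom p) ⟩
    (T-act D ∘ T₁ k) ∘ T₁ h   ≈⟨ pullʳ (≈-sym T-homomorphism) ⟩
    T-act D ∘ T₁ (k ∘ h)      ∎
  ∘-isHom {A} {B} {D} {h} {k} p q .F-hom = begin
    (k ∘ h) ∘ F-act A         ≈⟨ pullʳ (F-hom q) ⟩
    k ∘ F-act B ∘ F₁ h        ≈⟨ pullˡ (F-hom p) ⟩
    (F-act D ∘ F₁ k) ∘ F₁ h   ≈⟨ pullʳ (≈-sym homomorphism) ⟩
    F-act D ∘ F₁ (k ∘ h)      ∎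

  module _ (I : ∀ X → InitialAlgebra (Step X)) where
    private module I X = InitialAlgebra (I X)

    -- The `T`-action is the free algebra `μ` transported along the isomorphism `α`. Its two laws
    -- are therefore monad laws of `T`, once the inner pairs of `α` and `α⁻¹` cancel.
    free : Obj → Bialgebra
    free X .carrier = I.carrier X
    free X .T-act = T-structure I X
    free X .F-act = F-structure I X
    free X .act-unit = begin
      (I.α X ∘ μ _ ∘ T₁ (I.α⁻¹ X)) ∘ η _   ≈⟨ pullʳ (pullʳ (≈-sym (η-natural _))) ⟩
      I.α X ∘ μ _ ∘ η _ ∘ I.α⁻¹ X          ≈⟨ I.α X ∘⟨ cancelˡ μ-identityʳ ⟩
      I.α X ∘ I.α⁻¹ X                      ≈⟨ I.α∘α⁻¹ X ⟩
      id                                   ∎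
    free X .act-mult = begin
      (I.α X ∘ μ _ ∘ T₁ (I.α⁻¹ X)) ∘ T₁ (I.α X ∘ μ _ ∘ T₁ (I.α⁻¹ X))
        ≈⟨ pullʳ (pullʳ (≈-sym T-homomorphism)) ⟩
      I.α X ∘ μ _ ∘ T₁ (I.α⁻¹ X ∘ I.α X ∘ μ _ ∘ T₁ (I.α⁻¹ X))
        ≈⟨ I.α X ∘⟨ μ _ ∘⟨ T-resp-≈ (cancelˡ (I.α⁻¹∘α X)) ⟩
      I.α X ∘ μ _ ∘ T₁ (μ _ ∘ T₁ (I.α⁻¹ X))
        ≈⟨ I.α X ∘⟨ μ _ ∘⟨ T-homomorphism ⟩
      I.α X ∘ μ _ ∘ T₁ (μ _) ∘ T₁ (T₁ (I.α⁻¹ X))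
        ≈⟨ I.α X ∘⟨ swapˡ μ-assoc ⟩
      I.α X ∘ μ _ ∘ μ _ ∘ T₁ (T₁ (I.α⁻¹ X))
        ≈⟨ I.α X ∘⟨ μ _ ∘⟨ μ-natural _ ⟩
      I.α X ∘ μ _ ∘ T₁ (I.α⁻¹ X) ∘ μ _
        ≈⟨ ≈-trans assoc (_ ∘⟨ assoc) ⟨
      (I.α X ∘ μ _ ∘ T₁ (I.α⁻¹ X)) ∘ μ _ ∎

    -- The transported action extends any map of the form `α ∘ η ∘ q` in the way that the free
    -- algebra `μ` extends `η ∘ q`. With `q = id` it exhibits `α` itself as the extension of its
    -- restriction to generators.
    free-act-η : ∀ {X Z} {q : Z ⇒ F₀ (I.carrier X) ∐ X} → T-structure I X ∘ T₁ (I.α X ∘ η _ ∘ q) ≈ I.α X ∘ T₁ q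
    free-act-η {X} {Z} {q} = begin
      (I.α X ∘ μ _ ∘ T₁ (I.α⁻¹ X)) ∘ T₁ (I.α X ∘ η _ ∘ q)
        ≈⟨ pullʳ (pullʳ (≈-sym T-homomorphism)) ⟩
      I.α X ∘ μ _ ∘ T₁ (I.α⁻¹ X ∘ I.α X ∘ η _ ∘ q)
        ≈⟨ I.α X ∘⟨ μ _ ∘⟨ T-resp-≈ (cancelˡ (I.α⁻¹∘α X)) ⟩
      I.α X ∘ μ _ ∘ T₁ (η _ ∘ q)
        ≈⟨ I.α X ∘⟨ μ _ ∘⟨ T-homomorphism ⟩
      I.α X ∘ μ _ ∘ T₁ (η _) ∘ T₁ q
        ≈⟨ I.α X ∘⟨ cancelˡ μ-identityˡ ⟩
      I.α X ∘ T₁ q ∎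

    module _ {X : Obj} (B : Bialgebra) (y : X ⇒ carrier B) where
      -- This `Step X`-algebra packs both actions and `y` into one map. The maps from the initial
      -- algebra to it are exactly the bialgebra homomorphisms that restrict to `y`: `lift-isHom`
      -- gives one direction, `lift-unique` the other.
      algebra : T₀ (F₀ (carrier B) ∐ X) ⇒ carrier B
      algebra = T-act B ∘ T₁ ⁅ F-act B , y ⁆

      lift : I.carrier X ⇒ carrier B
      lift = I.fold X algebra

      algebra-∐₁ : ∀ (h : I.carrier X ⇒ carrier B) →
                     algebra ∘ T₁ (F₁ h ∐₁ id) ≈ T-act B ∘ T₁ ⁅ F-act B ∘ F₁ h , y ⁆
      algebra-∐₁ h = pullʳ (≈-trans (≈-sym T-homomorphism)
        (T-resp-≈ (≈-trans copair-∐₁ (copair-resp-≈ ≈-refl identityʳ))))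

      lift-α : lift ∘ I.α X ≈ T-act B ∘ T₁ ⁅ F-act B ∘ F₁ lift , y ⁆
      lift-α = ≈-trans (I.fold-comm X algebra) (algebra-∐₁ lift)

      lift-α-η : lift ∘ I.α X ∘ η _ ≈ ⁅ F-act B ∘ F₁ lift , y ⁆
      lift-α-η = begin
        lift ∘ I.α X ∘ η _                            ≈⟨ pullˡ lift-α ⟩
        (T-act B ∘ T₁ ⁅ F-act B ∘ F₁ lift , y ⁆) ∘ η _     ≈⟨ pullʳ (≈-sym (η-natural _)) ⟩
        T-act B ∘ η _ ∘ ⁅ F-act B ∘ F₁ lift , y ⁆          ≈⟨ cancelˡ (act-unit B) ⟩
        ⁅ F-act B ∘ F₁ lift , y ⁆                        ∎

      lift-unit : lift ∘ R-unit I X ≈ y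
      lift-unit = begin
        lift ∘ I.α X ∘ η _ ∘ inr               ≈⟨ _ ∘⟨ assoc ⟨
        lift ∘ (I.α X ∘ η _) ∘ inr             ≈⟨ pullˡ lift-α-η ⟩
        ⁅ F-act B ∘ F₁ lift , y ⁆ ∘ inr           ≈⟨ inject₂ ⟩
        y                                      ∎

      -- The `F`-part is the left component of `lift-α-η`. For the `T`-part, `lift-α` says that
      -- `lift ∘ α` is the extension of a copairing to the free `T`-algebra, hence a
      -- `T`-homomorphism, and the domain is transported along `α`.
      lift-isHom : IsHom (free X) B lift
      lift-isHom .F-hom = begin
        lift ∘ I.α X ∘ η _ ∘ inl               ≈⟨ _ ∘⟨ assoc ⟨
        lift ∘ (I.α X ∘ η _) ∘ inl             ≈⟨ pullˡ lift-α-η ⟩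
        ⁅ F-act B ∘ F₁ lift , y ⁆ ∘ inl           ≈⟨ inject₁ ⟩
        F-act B ∘ F₁ lift                         ∎
      lift-isHom .T-hom = begin
        lift ∘ I.α X ∘ μ _ ∘ T₁ (I.α⁻¹ X)           ≈⟨ pullˡ lift-α ⟩
        (T-act B ∘ T₁ q) ∘ μ _ ∘ T₁ (I.α⁻¹ X)         ≈⟨ assoc ⟩
        T-act B ∘ T₁ q ∘ μ _ ∘ T₁ (I.α⁻¹ X)           ≈⟨ _ ∘⟨ swapˡ (≈-sym (μ-natural q)) ⟩
        T-act B ∘ μ _ ∘ T₁ (T₁ q) ∘ T₁ (I.α⁻¹ X)      ≈⟨ swapˡ (≈-sym (act-mult B)) ⟩
        T-act B ∘ T₁ (T-act B) ∘ T₁ (T₁ q) ∘ T₁ (I.α⁻¹ X)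
          ≈⟨ _ ∘⟨ ≈-trans T-homomorphism (_ ∘⟨ T-homomorphism) ⟨
        T-act B ∘ T₁ (T-act B ∘ T₁ q ∘ I.α⁻¹ X)
          ≈⟨ _ ∘⟨ T-resp-≈ (≈-trans (≈-sym assoc) (≈-trans (≈-sym lift-α ⟩∘ _) assoc)) ⟩
        T-act B ∘ T₁ (lift ∘ I.α X ∘ I.α⁻¹ X)
          ≈⟨ _ ∘⟨ T-resp-≈ (≈-trans (_ ∘⟨ I.α∘α⁻¹ X) identityʳ) ⟩
        T-act B ∘ T₁ lift ∎
        where q = ⁅ F-act B ∘ F₁ lift , y ⁆

      lift-unique : ∀ h → IsHom (free X) B h → h ∘ R-unit I X ≈ y → h ≈ lift
      lift-unique h p u = I.fold-uniq X h (begin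
        -- The inserted `T₁ id` lets `free-act-η` rewrite `α` as the extension of `α ∘ η`, so that
        -- the homomorphism law of `h` applies although `α` is not written as a `T`-action.
        h ∘ I.α X                                        ≈⟨ _ ∘⟨ ≈-trans (_ ∘⟨ T-identity) identityʳ ⟨
        h ∘ I.α X ∘ T₁ id                                ≈⟨ _ ∘⟨ free-act-η ⟨
        h ∘ T-structure I X ∘ T₁ (I.α X ∘ η _ ∘ id)      ≈⟨ swapˡ (T-hom p) ⟩
        T-act B ∘ T₁ h ∘ T₁ (I.α X ∘ η _ ∘ id)             ≈⟨ _ ∘⟨ T-homomorphism ⟨
        T-act B ∘ T₁ (h ∘ I.α X ∘ η _ ∘ id)                ≈⟨ _ ∘⟨ T-resp-≈ on-generators ⟩
        T-act B ∘ T₁ ⁅ F-act B ∘ F₁ h , y ⁆                   ≈⟨ algebra-∐₁ h ⟨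
        algebra ∘ T₁ (F₁ h ∐₁ id)                      ∎)
        where
        regroup : ∀ {Z} (i : Z ⇒ _) → (h ∘ I.α X ∘ η _ ∘ id) ∘ i ≈ h ∘ I.α X ∘ η _ ∘ i
        regroup i = pullʳ (pullʳ (pullʳ identityˡ))
        on-generators : h ∘ I.α X ∘ η _ ∘ id ≈ ⁅ F-act B ∘ F₁ h , y ⁆
        on-generators = ≈-sym (unique (≈-trans (regroup inl) (F-hom p)) (≈-trans (regroup inr) u))

    hom-unique : ∀ {X} (B : Bialgebra) {h k : I.carrier X ⇒ carrier B} → IsHom (free X) B h → IsHom (free X) B k →
                 h ∘ R-unit I X ≈ k ∘ R-unit I X → h ≈ k
    hom-unique B {h} {k} p q u =
      ≈-trans (lift-unique B _ h p u) (≈-sym (lift-unique B _ k q ≈-refl))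

    -- `R₁` is defined as a fold of `α ∘ T₁ (id ∐₁ f)`, which hides that it preserves both actions.
    -- By `free-act-η` that algebra is the one built from `free Y` and the generators `R-unit ∘ f`.
    R₁-lift : ∀ {X Y} (f : X ⇒ Y) → R₁ I f ≈ lift (free Y) (R-unit I Y ∘ f)
    R₁-lift {X} {Y} f = I.fold-uniq X (R₁ I f) (≈-trans (I.fold-comm X _) (algebra-free ⟩∘ _))
      where
      algebra-free : I.α Y ∘ T₁ (id ∐₁ f) ≈ algebra (free Y) (R-unit I Y ∘ f)
      algebra-free = ≈-trans (≈-sym free-act-η) (_ ∘⟨ T-resp-≈ (≈-sym (unique
        (≈-trans (pullʳ (pullʳ inject₁)) (_ ∘⟨ _ ∘⟨ identityʳ))
        (≈-trans (pullʳ (pullʳ inject₂)) (≈-sym (≈-trans assoc (_ ∘⟨ assoc)))))))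

    R₁-isHom : ∀ {X Y} (f : X ⇒ Y) → IsHom (free X) (free Y) (R₁ I f)
    R₁-isHom f = IsHom-resp-≈ (≈-sym (R₁-lift f)) (lift-isHom _ _)

    R₁-unit : ∀ {X Y} (f : X ⇒ Y) → R₁ I f ∘ R-unit I X ≈ R-unit I Y ∘ f
    R₁-unit f = ≈-trans (R₁-lift f ⟩∘ _) (lift-unit (free _) _)

    mult : ∀ X → R₀ I (R₀ I X) ⇒ R₀ I X
    mult X = lift (free X) id

    mult-isHom : ∀ X → IsHom (free (R₀ I X)) (free X) (mult X)
    mult-isHom X = lift-isHom (free X) id

    mult-unit : ∀ {X} → mult X ∘ R-unit I (R₀ I X) ≈ id
    mult-unit {X} = lift-unit (free X) id

    canonicalMonad : CanonicalMonad I
    canonicalMonad = record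
      { mult = mult
      ; isMultiplication = λ X → record
        { T-hom = T-hom (mult-isHom X) ; F-hom = F-hom (mult-isHom X) ; restricts = mult-unit }
      ; mult-unique = λ {X} m p → let module p = IsMultiplication p in
          lift-unique (free X) id m (record { T-hom = p.T-hom ; F-hom = p.F-hom }) p.restricts
      ; unit-natural = λ f → ≈-sym (R₁-unit f)
      ; mult-natural = λ {X} {Y} f → hom-unique (free Y)
          (∘-isHom (mult-isHom Y) (R₁-isHom (R₁ I f))) (∘-isHom (R₁-isHom f) (mult-isHom X))
          (begin
            (mult Y ∘ R₁ I (R₁ I f)) ∘ R-unit I _   ≈⟨ pullʳ (R₁-unit (R₁ I f)) ⟩
            mult Y ∘ R-unit I _ ∘ R₁ I f            ≈⟨ cancelˡ mult-unit ⟩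
            R₁ I f                                  ≈⟨ ≈-trans (pullʳ mult-unit) identityʳ ⟨
            (R₁ I f ∘ mult X) ∘ R-unit I _          ∎)
      ; mult-assoc = λ {X} → hom-unique (free X)
          (∘-isHom (mult-isHom X) (R₁-isHom (mult X))) (∘-isHom (mult-isHom X) (mult-isHom (R₀ I X)))
          (begin
            (mult X ∘ R₁ I (mult X)) ∘ R-unit I _   ≈⟨ pullʳ (R₁-unit (mult X)) ⟩
            mult X ∘ R-unit I _ ∘ mult X            ≈⟨ cancelˡ mult-unit ⟩
            mult X                                  ≈⟨ ≈-trans (pullʳ mult-unit) identityʳ ⟨
            (mult X ∘ mult (R₀ I X)) ∘ R-unit I _   ∎)
      ; mult-identityˡ = λ {X} → hom-unique (free X)
          (∘-isHom (mult-isHom X) (R₁-isHom (R-unit I X))) id-isHom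
          (begin
            (mult X ∘ R₁ I (R-unit I X)) ∘ R-unit I X   ≈⟨ pullʳ (R₁-unit (R-unit I X)) ⟩
            mult X ∘ R-unit I _ ∘ R-unit I X            ≈⟨ cancelˡ mult-unit ⟩
            R-unit I X                                  ≈⟨ identityˡ ⟨
            id ∘ R-unit I X                             ∎)
      ; mult-identityʳ = mult-unit
      }

-- Uniqueness of initial algebras.

module _ {o ℓ e} {C : Category o ℓ e} {H : Functor C C} where
  open Category C
  open HomReasoning C
  open Functor H renaming (F₁ to H₁; identity to H-id; homomorphism to H-∘)
  open InitialAlgebra

  -- The composite and the identity are both algebra endomorphisms of `J`. Exchanging `I` and `J`
  -- gives the other half of the isomorphism.
  fold-inverse : (I J : InitialAlgebra H) → fold I (α J) ∘ fold J (α I) ≈ id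
  fold-inverse I J = fold-uniq₂ J (α J) _ _
    (begin
      (fold I (α J) ∘ fold J (α I)) ∘ α J            ≈⟨ pullʳ (fold-comm J (α I)) ⟩
      fold I (α J) ∘ α I ∘ H₁ (fold J (α I))         ≈⟨ pullˡ (fold-comm I (α J)) ⟩
      (α J ∘ H₁ (fold I (α J))) ∘ H₁ (fold J (α I))  ≈⟨ pullʳ (≈-sym H-∘) ⟩
      α J ∘ H₁ (fold I (α J) ∘ fold J (α I))         ∎)
    (≈-trans identityˡ (≈-sym (≈-trans (_ ∘⟨ H-id) identityʳ)))

-- Free bialgebras over an adjunction, and their comparison with resumptions.

module FreeBialgebras {o ℓ e o′ ℓ′ e′} {C : Category o ℓ e} {D : Category o′ ℓ′ e′} {G : Functor D C}
                      (L : LeftAdjoint G) (coproducts : BinaryCoproducts C) (F : Functor C C) where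
  private module D = Category D
  open Category C
  open HomReasoning C
  open BinaryCoproducts coproducts renaming ([_,_] to ⁅_,_⁆)
  open CoproductProperties coproducts
  open Functor F using (F₀; F₁; identity; homomorphism; F-resp-≈)
  open Functor G renaming (F₀ to G₀; F₁ to G₁; identity to G-id; homomorphism to G-∘; F-resp-≈ to G-resp-≈)
  open LeftAdjoint L
  open Monad (inducedMonad L) using (T₁; μ)
  open Resumption coproducts (inducedMonad L) F
  open Bialgebras coproducts (inducedMonad L) F

  hom-ext : ∀ {X B} {h k : Free X D.⇒ B} → G₁ h ∘ unit X ≈ G₁ k ∘ unit X → h D.≈ k
  hom-ext p = D.≈-trans (extend-uniq _ p) (D.≈-sym (extend-uniq _ ≈-refl))

  counit : ∀ A → Free (G₀ A) D.⇒ A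
  counit A = extend id

  -- Translates between the two ways to extend a map from generators: by a `T`-action, as in
  -- `algebra`, and by the adjunction, as in `structure`.
  counit-T₁ : ∀ {A X} (h : X ⇒ G₀ A) → G₁ (counit A) ∘ T₁ h ≈ G₁ (extend h)
  counit-T₁ {A} h = ≈-trans (≈-sym G-∘) (G-resp-≈ (hom-ext (begin
    G₁ (counit A D.∘ extend (unit _ ∘ h)) ∘ unit _          ≈⟨ G-∘ ⟩∘ _ ⟩
    (G₁ (counit A) ∘ G₁ (extend (unit _ ∘ h))) ∘ unit _     ≈⟨ pullʳ (extend-∘ _) ⟩
    G₁ (counit A) ∘ unit _ ∘ h                              ≈⟨ cancelˡ (extend-∘ id) ⟩
    h                                                       ≈⟨ extend-∘ h ⟨
    G₁ (extend h) ∘ unit _                                  ∎)))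

  -- Every morphism of `D` is a homomorphism of the induced `T`-actions. Since `μ` is itself the
  -- image of a counit, the associativity law `counit-mult` is the instance at the counit.
  counit-natural : ∀ {A B} (h : A D.⇒ B) → G₁ h ∘ G₁ (counit A) ≈ G₁ (counit B) ∘ T₁ (G₁ h)
  counit-natural {A} h = ≈-trans (≈-trans (≈-sym G-∘) (G-resp-≈ (extend-uniq _ (begin
    G₁ (h D.∘ counit A) ∘ unit _         ≈⟨ G-∘ ⟩∘ _ ⟩
    (G₁ h ∘ G₁ (counit A)) ∘ unit _      ≈⟨ pullʳ (extend-∘ id) ⟩
    G₁ h ∘ id                            ≈⟨ identityʳ ⟩
    G₁ h                                 ∎)))) (≈-sym (counit-T₁ (G₁ h)))

  counit-unit : ∀ A → G₁ (counit A) ∘ unit (G₀ A) ≈ id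
  counit-unit A = extend-∘ id

  counit-mult : ∀ A → G₁ (counit A) ∘ T₁ (G₁ (counit A)) ≈ G₁ (counit A) ∘ μ (G₀ A)
  counit-mult A = ≈-sym (counit-natural (counit A))

  -- Bialgebras appear here as objects of `D` with an `F`-action on the underlying object, and
  -- morphisms of `D` take the place of `T`-homomorphisms.
  record FreeBialgebra (X : Obj) : Set (o ⊔ ℓ ⊔ e ⊔ o′ ⊔ ℓ′ ⊔ e′) where
    field
      A           : D.Obj
      act         : F₀ (G₀ A) ⇒ G₀ A
      gen         : X ⇒ G₀ A
      ext        : ∀ {B} → F₀ (G₀ B) ⇒ G₀ B → X ⇒ G₀ B → A D.⇒ B
      ext-act    : ∀ {B} (b : F₀ (G₀ B) ⇒ G₀ B) (y : X ⇒ G₀ B) → G₁ (ext b y) ∘ act ≈ b ∘ F₁ (G₁ (ext b y))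
      ext-gen    : ∀ {B} (b : F₀ (G₀ B) ⇒ G₀ B) (y : X ⇒ G₀ B) → G₁ (ext b y) ∘ gen ≈ y
      ext-unique : ∀ {B} {b : F₀ (G₀ B) ⇒ G₀ B} {y : X ⇒ G₀ B} (h : A D.⇒ B) →
                    G₁ h ∘ act ≈ b ∘ F₁ (G₁ h) → G₁ h ∘ gen ≈ y → h D.≈ ext b y

    structure : Free (F₀ (G₀ A) ∐ X) D.⇒ A
    structure = extend ⁅ act , gen ⁆

    structure-unit-inl : G₁ structure ∘ unit _ ∘ inl ≈ act
    structure-unit-inl = ≈-trans (pullˡ (extend-∘ _)) inject₁

    structure-unit-inr : G₁ structure ∘ unit _ ∘ inr ≈ gen
    structure-unit-inr = ≈-trans (pullˡ (extend-∘ _)) inject₂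

    -- Free (F B + X) is a bialgebra under X, with F acting through h; folding h is the ext to it, followed by h.
    module _ {B : Obj} (h : G₀ (Free (F₀ B ∐ X)) ⇒ B) where
      unfold : A D.⇒ Free (F₀ B ∐ X)
      unfold = ext ((unit _ ∘ inl) ∘ F₁ h) (unit _ ∘ inr)

      -- Composed with `h`, this is the fold equation for `h ∘ G₁ unfold`. Both sides come from
      -- morphisms out of a free object, so they are compared on the two summands of its generators.
      unfold-structure : G₁ unfold ∘ G₁ structure ≈ T₁ (F₁ (h ∘ G₁ unfold) ∐₁ id)
      unfold-structure = ≈-trans (≈-sym G-∘) (G-resp-≈ (extend-uniq _ (begin
        G₁ (unfold D.∘ structure) ∘ unit _               ≈⟨ G-∘ ⟩∘ _ ⟩
        (G₁ unfold ∘ G₁ structure) ∘ unit _              ≈⟨ pullʳ (extend-∘ _) ⟩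
        G₁ unfold ∘ ⁅ act , gen ⁆                        ≈⟨ copair-unique₂ left right ⟩
        unit _ ∘ (F₁ (h ∘ G₁ unfold) ∐₁ id)              ∎)))
        where
        left : (G₁ unfold ∘ ⁅ act , gen ⁆) ∘ inl ≈ (unit _ ∘ (F₁ (h ∘ G₁ unfold) ∐₁ id)) ∘ inl
        left = begin
          (G₁ unfold ∘ ⁅ act , gen ⁆) ∘ inl                  ≈⟨ pullʳ inject₁ ⟩
          G₁ unfold ∘ act                                    ≈⟨ ext-act _ _ ⟩
          ((unit _ ∘ inl) ∘ F₁ h) ∘ F₁ (G₁ unfold)           ≈⟨ pullʳ (≈-sym homomorphism) ⟩
          (unit _ ∘ inl) ∘ F₁ (h ∘ G₁ unfold)                ≈⟨ assoc ⟩
          unit _ ∘ inl ∘ F₁ (h ∘ G₁ unfold)                  ≈⟨ pullʳ inject₁ ⟨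
          (unit _ ∘ (F₁ (h ∘ G₁ unfold) ∐₁ id)) ∘ inl        ∎
        right : (G₁ unfold ∘ ⁅ act , gen ⁆) ∘ inr ≈ (unit _ ∘ (F₁ (h ∘ G₁ unfold) ∐₁ id)) ∘ inr
        right = begin
          (G₁ unfold ∘ ⁅ act , gen ⁆) ∘ inr                  ≈⟨ pullʳ inject₂ ⟩
          G₁ unfold ∘ gen                                    ≈⟨ ext-gen _ _ ⟩
          unit _ ∘ inr                                       ≈⟨ _ ∘⟨ identityʳ ⟨
          unit _ ∘ inr ∘ id                                  ≈⟨ pullʳ inject₂ ⟨
          (unit _ ∘ (F₁ (h ∘ G₁ unfold) ∐₁ id)) ∘ inr        ∎

    -- One half of Lambek's lemma: unfolding and then applying `structure` is an endomorphism of the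
    -- free bialgebra that fixes the generators, hence the identity.
    structure∘unfold : G₁ structure ∘ G₁ (unfold (G₁ structure)) ≈ id
    structure∘unfold = ≈-trans (≈-sym G-∘) (≈-trans (G-resp-≈ (D.≈-trans
      (ext-unique (structure D.∘ β) (begin
        G₁ (structure D.∘ β) ∘ act                                      ≈⟨ G-∘ ⟩∘ _ ⟩
        (G₁ structure ∘ G₁ β) ∘ act                                     ≈⟨ pullʳ (ext-act _ _) ⟩
        G₁ structure ∘ ((unit _ ∘ inl) ∘ F₁ (G₁ structure)) ∘ F₁ (G₁ β) ≈⟨ _ ∘⟨ pullʳ (≈-sym homomorphism) ⟩
        G₁ structure ∘ (unit _ ∘ inl) ∘ F₁ (G₁ structure ∘ G₁ β)        ≈⟨ pullˡ structure-unit-inl ⟩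
        act ∘ F₁ (G₁ structure ∘ G₁ β)                                  ≈⟨ _ ∘⟨ F-resp-≈ G-∘ ⟨
        act ∘ F₁ (G₁ (structure D.∘ β))                                 ∎)
      (≈-trans (G-∘ ⟩∘ _) (≈-trans (pullʳ (ext-gen _ _)) structure-unit-inr)))
      (D.≈-sym (ext-unique D.id
        (≈-trans (G-id ⟩∘ _) (≈-trans identityˡ (≈-sym (≈-trans (_ ∘⟨ ≈-trans (F-resp-≈ G-id) identity) identityʳ))))
        (≈-trans (G-id ⟩∘ _) identityˡ)))))
      G-id)
      where β = unfold (G₁ structure)

    initialAlgebra : InitialAlgebra (Step X)
    initialAlgebra = record
      { carrier   = G₀ A
      ; α         = G₁ structure
      ; fold      = λ h → h ∘ G₁ (unfold h)
      ; fold-comm = λ h → pullʳ (unfold-structure h)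
      ; fold-uniq = fold-uniq
      }
      where
      fold-uniq : ∀ {B} {h : G₀ (Free (F₀ B ∐ X)) ⇒ B} (g : G₀ A ⇒ B) →
                  g ∘ G₁ structure ≈ h ∘ T₁ (F₁ g ∐₁ id) → g ≈ h ∘ G₁ (unfold h)
      -- A solution `g` is only a morphism of `C`, out of reach of `ext-unique`. But
      -- `structure∘unfold` and the equation `p` factor it as `h` after `G₁ γ`, and `γ` is a
      -- morphism of `D`.
      fold-uniq {B} {h} g p = ≈-trans g≈hγ (_ ∘⟨ ≈-trans (≈-sym G-∘) (G-resp-≈ γ-unfold))
        where
        β : A D.⇒ Free (F₀ (G₀ A) ∐ X)
        β = unfold (G₁ structure)
        γ : A D.⇒ Free (F₀ B ∐ X)
        γ = extend (unit _ ∘ (F₁ g ∐₁ id)) D.∘ β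
        g≈hγ : g ≈ h ∘ T₁ (F₁ g ∐₁ id) ∘ G₁ β
        g≈hγ = begin
          g                                  ≈⟨ identityʳ ⟨
          g ∘ id                             ≈⟨ _ ∘⟨ structure∘unfold ⟨
          g ∘ G₁ structure ∘ G₁ β            ≈⟨ swapˡ p ⟩
          h ∘ T₁ (F₁ g ∐₁ id) ∘ G₁ β         ∎
        γ-unfold : γ D.≈ unfold h
        γ-unfold = ext-unique γ
          (begin
            G₁ γ ∘ act                                            ≈⟨ G-∘ ⟩∘ _ ⟩
            (T₁ (F₁ g ∐₁ id) ∘ G₁ β) ∘ act                        ≈⟨ pullʳ (ext-act _ _) ⟩
            T₁ (F₁ g ∐₁ id) ∘ ((unit _ ∘ inl) ∘ F₁ (G₁ structure)) ∘ F₁ (G₁ β)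
              ≈⟨ _ ∘⟨ pullʳ (≈-trans (≈-sym homomorphism) (≈-trans (F-resp-≈ structure∘unfold) identity)) ⟩
            T₁ (F₁ g ∐₁ id) ∘ (unit _ ∘ inl) ∘ id                 ≈⟨ _ ∘⟨ identityʳ ⟩
            T₁ (F₁ g ∐₁ id) ∘ unit _ ∘ inl                        ≈⟨ pullˡ (extend-∘ _) ⟩
            (unit _ ∘ (F₁ g ∐₁ id)) ∘ inl                         ≈⟨ pullʳ inject₁ ⟩
            unit _ ∘ inl ∘ F₁ g                                   ≈⟨ assoc ⟨
            (unit _ ∘ inl) ∘ F₁ g
              -- Substituting the factorization of `g` under `F₁` yields the action through `h`,
              -- which makes `γ` a homomorphism to the bialgebra that defines `unfold h`.
              ≈⟨ _ ∘⟨ F-resp-≈ (≈-trans g≈hγ (_ ∘⟨ ≈-sym G-∘)) ⟩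
            (unit _ ∘ inl) ∘ F₁ (h ∘ G₁ γ)                        ≈⟨ pullʳ (≈-sym homomorphism) ⟨
            ((unit _ ∘ inl) ∘ F₁ h) ∘ F₁ (G₁ γ)                   ∎)
          (begin
            G₁ γ ∘ gen                                            ≈⟨ G-∘ ⟩∘ _ ⟩
            (T₁ (F₁ g ∐₁ id) ∘ G₁ β) ∘ gen                        ≈⟨ pullʳ (ext-gen _ _) ⟩
            T₁ (F₁ g ∐₁ id) ∘ unit _ ∘ inr                        ≈⟨ pullˡ (extend-∘ _) ⟩
            (unit _ ∘ (F₁ g ∐₁ id)) ∘ inr                         ≈⟨ pullʳ inject₂ ⟩
            unit _ ∘ inr ∘ id                                     ≈⟨ _ ∘⟨ identityʳ ⟩
            unit _ ∘ inr                                          ∎)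

    bialgebra : Bialgebra
    bialgebra = record
      { carrier  = G₀ A
      ; T-act    = G₁ (counit A)
      ; act-unit = counit-unit A
      ; act-mult = counit-mult A
      ; F-act    = act
      }

    module _ (I : ∀ X → InitialAlgebra (Step X)) where
      private module I X = InitialAlgebra (I X)

      to : I.carrier X ⇒ G₀ A
      to = lift I bialgebra gen

      from : G₀ A ⇒ I.carrier X
      from = InitialAlgebra.fold initialAlgebra (I.α X)

      -- The comparison map has two descriptions: as a `lift` it is a bialgebra homomorphism, as a
      -- fold between two initial algebras it is invertible.
      to-fold : to ≈ I.fold X (G₁ structure)
      to-fold = I.fold-uniq X to (≈-trans (I.fold-comm X _) (counit-T₁ ⁅ act , gen ⁆ ⟩∘ _))

      to∘from : to ∘ from ≈ id
      to∘from = ≈-trans (to-fold ⟩∘ from) (fold-inverse (I X) initialAlgebra)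

      from∘to : from ∘ to ≈ id
      from∘to = ≈-trans (from ∘⟨ to-fold) (fold-inverse initialAlgebra (I X))

  -- In the application enter and leave are identities: they spare Agda from comparing the two carriers as objects of C.
  record FreeBialgebraMonad (N : Monad C) : Set (o ⊔ ℓ ⊔ e ⊔ o′ ⊔ ℓ′ ⊔ e′) where
    private module N = Monad N
    field
      freeBialgebra : ∀ X → FreeBialgebra X
    private module B X = FreeBialgebra (freeBialgebra X)
    field
      enter        : ∀ X → N.T₀ X ⇒ G₀ (B.A X)
      leave        : ∀ X → G₀ (B.A X) ⇒ N.T₀ X
      enter∘leave  : ∀ X → enter X ∘ leave X ≈ id
      leave∘enter  : ∀ X → leave X ∘ enter X ≈ id
      enter-η      : ∀ X → enter X ∘ N.η X ≈ B.gen X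
      map          : ∀ {X Y} → X ⇒ Y → B.A X D.⇒ B.A Y
      map-act      : ∀ {X Y} (f : X ⇒ Y) → G₁ (map f) ∘ B.act X ≈ B.act Y ∘ F₁ (G₁ (map f))
      enter-T₁     : ∀ {X Y} (f : X ⇒ Y) → enter Y ∘ N.T₁ f ≈ G₁ (map f) ∘ enter X
      join         : ∀ X → B.A (N.T₀ X) D.⇒ B.A X
      join-act     : ∀ X → G₁ (join X) ∘ B.act (N.T₀ X) ≈ B.act X ∘ F₁ (G₁ (join X))
      enter-μ      : ∀ X → enter X ∘ N.μ X ≈ G₁ (join X) ∘ enter (N.T₀ X)

  module _ {N : Monad C} (P : FreeBialgebraMonad N) (I : ∀ X → InitialAlgebra (Step X)) where
    open FreeBialgebraMonad P
    private
      module N = Monad N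
      module I X = InitialAlgebra (I X)
      module B X = FreeBialgebra (freeBialgebra X)

      cmp : ∀ X → I.carrier X ⇒ G₀ (B.A X)
      cmp X = B.to X I

      cmp-isHom : ∀ X → IsHom (free I X) (B.bialgebra X) (cmp X)
      cmp-isHom X = lift-isHom I (B.bialgebra X) (B.gen X)

      cmp-unit : ∀ X → cmp X ∘ R-unit I X ≈ B.gen X
      cmp-unit X = lift-unit I (B.bialgebra X) (B.gen X)

      isHom : ∀ {X Y} (h : B.A X D.⇒ B.A Y) → G₁ h ∘ B.act X ≈ B.act Y ∘ F₁ (G₁ h) →
              IsHom (B.bialgebra X) (B.bialgebra Y) (G₁ h)
      isHom h p = record { T-hom = counit-natural h ; F-hom = p }

      to : ∀ X → I.carrier X ⇒ N.T₀ X
      to X = leave X ∘ cmp X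

      cmp-natural : ∀ {X Y} (f : X ⇒ Y) → cmp Y ∘ R₁ I f ≈ G₁ (map f) ∘ cmp X
      cmp-natural {X} {Y} f = hom-unique I (B.bialgebra Y)
        (∘-isHom (cmp-isHom Y) (R₁-isHom I f)) (∘-isHom (isHom (map f) (map-act f)) (cmp-isHom X))
        (begin
          (cmp Y ∘ R₁ I f) ∘ R-unit I X          ≈⟨ pullʳ (R₁-unit I f) ⟩
          cmp Y ∘ R-unit I Y ∘ f                 ≈⟨ pullˡ (cmp-unit Y) ⟩
          B.gen Y ∘ f                            ≈⟨ enter-η Y ⟩∘ f ⟨
          (enter Y ∘ N.η Y) ∘ f                  ≈⟨ pullʳ (N.η-natural f) ⟩
          enter Y ∘ N.T₁ f ∘ N.η X               ≈⟨ swapˡ (enter-T₁ f) ⟩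
          G₁ (map f) ∘ enter X ∘ N.η X           ≈⟨ _ ∘⟨ enter-η X ⟩
          G₁ (map f) ∘ B.gen X                   ≈⟨ pullʳ (cmp-unit X) ⟨
          (G₁ (map f) ∘ cmp X) ∘ R-unit I X      ∎)

      -- This is compatibility with multiplication, with `N.μ` and `N.T₁` replaced by the morphisms
      -- `join` and `map` of `D`. In this form both sides are visibly homomorphisms out of the free
      -- bialgebra.
      cmp-mult : ∀ X → cmp X ∘ mult I X ≈ G₁ (join X) ∘ G₁ (map (to X)) ∘ cmp (R₀ I X)
      cmp-mult X = hom-unique I (B.bialgebra X)
        (∘-isHom (cmp-isHom X) (mult-isHom I X))
        (∘-isHom (isHom (join X) (join-act X))
          (∘-isHom (isHom (map (to X)) (map-act (to X))) (cmp-isHom (R₀ I X))))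
        (begin
          (cmp X ∘ mult I X) ∘ R-unit I _                                 ≈⟨ pullʳ (mult-unit I) ⟩
          cmp X ∘ id                                                      ≈⟨ identityʳ ⟩
          cmp X                                                           ≈⟨ cancelˡ (enter∘leave X) ⟨
          enter X ∘ to X                                                  ≈⟨ _ ∘⟨ cancelˡ N.μ-identityʳ ⟨
          enter X ∘ N.μ X ∘ N.η _ ∘ to X                                  ≈⟨ _ ∘⟨ _ ∘⟨ N.η-natural (to X) ⟩
          enter X ∘ N.μ X ∘ N.T₁ (to X) ∘ N.η _                           ≈⟨ swapˡ (enter-μ X) ⟩
          G₁ (join X) ∘ enter _ ∘ N.T₁ (to X) ∘ N.η _                     ≈⟨ _ ∘⟨ swapˡ (enter-T₁ (to X)) ⟩
          G₁ (join X) ∘ G₁ (map (to X)) ∘ enter _ ∘ N.η _                 ≈⟨ _ ∘⟨ _ ∘⟨ enter-η _ ⟩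
          G₁ (join X) ∘ G₁ (map (to X)) ∘ B.gen _                         ≈⟨ pullʳ (pullʳ (cmp-unit _)) ⟨
          (G₁ (join X) ∘ G₁ (map (to X)) ∘ cmp (R₀ I X)) ∘ R-unit I _     ∎)

    resumption-iso : MonadIso (CanonicalMonad.monad (canonicalMonad I)) N
    resumption-iso = record
      { to      = to
      ; from    = λ X → B.from X I ∘ enter X
      ; to∘from = λ X → ≈-trans (pullʳ (cancelˡ (B.to∘from X I))) (leave∘enter X)
      ; from∘to = λ X → ≈-trans (pullʳ (cancelˡ (enter∘leave X))) (B.from∘to X I)
      ; natural = λ {X} {Y} f → begin
          (leave Y ∘ cmp Y) ∘ R₁ I f                   ≈⟨ pullʳ (cmp-natural f) ⟩
          leave Y ∘ G₁ (map f) ∘ cmp X                 ≈⟨ _ ∘⟨ _ ∘⟨ cancelˡ (enter∘leave X) ⟨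
          leave Y ∘ G₁ (map f) ∘ enter X ∘ to X        ≈⟨ _ ∘⟨ swapˡ (enter-T₁ f) ⟨
          leave Y ∘ enter Y ∘ N.T₁ f ∘ to X            ≈⟨ cancelˡ (leave∘enter Y) ⟩
          N.T₁ f ∘ to X                                ∎
      ; to-η    = λ X → begin
          (leave X ∘ cmp X) ∘ R-unit I X       ≈⟨ pullʳ (cmp-unit X) ⟩
          leave X ∘ B.gen X                    ≈⟨ _ ∘⟨ enter-η X ⟨
          leave X ∘ enter X ∘ N.η X            ≈⟨ cancelˡ (leave∘enter X) ⟩
          N.η X                                ∎
      ; to-μ    = λ X → begin
          (leave X ∘ cmp X) ∘ mult I X                                       ≈⟨ pullʳ (cmp-mult X) ⟩
          leave X ∘ G₁ (join X) ∘ G₁ (map (to X)) ∘ cmp (R₀ I X)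
            ≈⟨ _ ∘⟨ _ ∘⟨ _ ∘⟨ cancelˡ (enter∘leave _) ⟨
          leave X ∘ G₁ (join X) ∘ G₁ (map (to X)) ∘ enter _ ∘ to (R₀ I X)
            ≈⟨ _ ∘⟨ _ ∘⟨ swapˡ (enter-T₁ (to X)) ⟨
          leave X ∘ G₁ (join X) ∘ enter _ ∘ N.T₁ (to X) ∘ to (R₀ I X)        ≈⟨ _ ∘⟨ swapˡ (enter-μ X) ⟨
          leave X ∘ enter X ∘ N.μ X ∘ N.T₁ (to X) ∘ to (R₀ I X)              ≈⟨ cancelˡ (leave∘enter X) ⟩
          N.μ X ∘ N.T₁ (to X) ∘ to (R₀ I X)                                  ∎
      }

-- Contractive operators and the models of their theory.

splitAssignment : ∀ {A : Set} n → A → (x y : Fin n → A) →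
                  ∃[ ρ ] (∀ i → ρ (toℕ (i ↑ˡ n)) ≡ x i) × (∀ i → ρ (toℕ (n ↑ʳ i)) ≡ y i)
splitAssignment {A} n default x y = ρ , left , right
  where
  ρ : Var → A
  ρ k with k <? n +ᴺ n
  ... | yes k<2n = [ x , y ]′ (splitAt n (fromℕ< k<2n))
  -- The tuples `x` and `y` occupy the first `n` and the next `n` variables; an arbitrary value
  -- serves all later ones.
  ... | no _     = default
  ρ-toℕ : ∀ i → ρ (toℕ i) ≡ [ x , y ]′ (splitAt n i)
  ρ-toℕ i with toℕ i <? n +ᴺ n
  ... | yes p = cong (λ j → [ x , y ]′ (splitAt n j)) (fromℕ<-toℕ i p)
  ... | no ¬p = contradiction (toℕ<n i) ¬p
  left : ∀ i → ρ (toℕ (i ↑ˡ n)) ≡ x i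
  left i = trans (ρ-toℕ (i ↑ˡ n)) (cong [ x , y ]′ (splitAt-↑ˡ n i n))
  right : ∀ i → ρ (toℕ (n ↑ʳ i)) ≡ y i
  right i = trans (ρ-toℕ (n ↑ʳ i)) (cong [ x , y ]′ (splitAt-↑ʳ n n i))

module ContractiveOperators (C : ContractiveSignature) where
  open ContractiveSignature C

  -- The factor is below 1, so scaling only shrinks distances. Hence a map that is non-expansive on
  -- a summand of `Σ̃` is also non-expansive for the max metric.
  summand-⊑ : ∀ X f {x y : Fin (ar signature f) → ∣ X ∣} {r} →
              (∀ i → Met.d X (x i) (y i) ⊑ r) → Met.d (summand C X f) x y ⊑ r
  summand-⊑ X f {x} {y} {r} p = subst (real (factor f) *∞ D ⊑_) (*-identityˡ r)
    (*∞-⊑ (real (factor f)) D (⊑-1 {real (factor f)} (factor<1 f)) p)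
    where D = Met.d (Power (ar signature f) X) x y

  module _ (A : QAlg signature) where
    open QAlg A
    private module A = Met met

    IsContractive : Set
    IsContractive = ∀ f (x y : Fin (ar signature f) → ∣ met ∣) r →
                    Met.d (summand C met f) x y ⊑ r → A.d (fun (ops f) x) (fun (ops f) y) ⊑ r

    contractive⇒⊨𝒪 : IsContractive → A ⊨ 𝒪 C
    contractive⇒⊨𝒪 contr = ⊨-axioms (generated-axiomatizes (ContractiveAxiom C)) A
      λ { _ (contractive f x y ε δ cε≤δ) ρ p → contr f _ _ δ λ h h>0 →
            let (a , e , ca , ε≤e , le) = cε≤δ h h>0 in
            a , e , ca , (λ i → ⊑-upper (A.d (ρ (x i)) (ρ (y i))) ε≤e (p _ (∈-tabulate⁺ i))) , le }

    -- The scaled distance is an infimum of rational products: for each `h` there are rationals `a`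
    -- above the factor and `e` above the distance of the tuples with `a * e ≤ r + h`. The axiom for
    -- `e` and `r + h` bounds the distance of the results by `r + h`, and closedness of balls
    -- removes `h`.
    ⊨𝒪⇒contractive : A ⊨ 𝒪 C → IsContractive
    ⊨𝒪⇒contractive A⊨𝒪 f x y r p = ⊑-closed (A.d _ _) λ h h>0 →
      let n = ar signature f
          (a , e , ca , d , le) = p h h>0
          -- The default is a value of `f`, which supplies an element of the carrier even for arity
          -- 0.
          (ρ , ρx , ρy) = splitAssignment n (fun (ops f) x) x y
          cong-ops : ∀ {u v : Fin n → ∣ met ∣} → (∀ i → u i ≡ v i) → fun (ops f) u A.≈ fun (ops f) v
          cong-ops eq = op-cong f λ i → subst (λ w → w A.≈ _) (sym (eq i)) A.≈-refl
      in A.ball-resp (cong-ops ρx) (cong-ops ρy)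
        (A⊨𝒪 _ (axiom (contractive f (λ i → toℕ (i ↑ˡ n)) (λ i → toℕ (n ↑ʳ i)) e (r + h)
                         (⊑-upper (real (factor f) *∞ ⌊ e ⌋) le (*∞-⊑ (real (factor f)) ⌊ e ⌋ ca ≤-refl))))
          ρ (λ ψ m → premise ρ ρx ρy d ψ (∈-tabulate⁻ m)))
      where
      n = ar signature f
      premise : ∀ (ρ : Var → ∣ met ∣) → (∀ i → ρ (toℕ (i ↑ˡ n)) ≡ x i) → (∀ i → ρ (toℕ (n ↑ʳ i)) ≡ y i) →
                ∀ {e} → (∀ i → A.d (x i) (y i) ⊑ e) → ∀ ψ →
                Σ[ i ∈ Fin n ] ψ ≡ var (toℕ (i ↑ˡ n)) ≐[ e ] var (toℕ (n ↑ʳ i)) → Holds A ρ ψ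
      premise ρ ρx ρy {e} d _ (i , refl) = subst₂ (λ u v → A.d u v ⊑ e) (sym (ρx i)) (sym (ρy i)) (d i)

-- Abstracting over both monads makes the claim a type family, along which equalities of monads can
-- be transported.
IsFreeResumption : ∀ {o ℓ e} {C : Category o ℓ e} → BinaryCoproducts C → Functor C C → (T N : Monad C) → Set (o ⊔ ℓ ⊔ e)
IsFreeResumption {C = C} coproducts F T N =
  (∀ X → InitialAlgebra (Step X)) ×
  (∀ (I : ∀ X → InitialAlgebra (Step X)) → Σ[ R ∈ CanonicalMonad I ] MonadIso (CanonicalMonad.monad R) N)
  where open Resumption coproducts T F

-- Models of the sum as models of `U` with a `Σ̃`-algebra structure.

module SumModels (C : ContractiveSignature) {S : Signature} (U : Theory S) (U-closed : ClosedUnderCompletion U) where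
  open ContractiveSignature C using (signature)
  open ContractiveOperators C

  U-reduct : Model (U ⊕ 𝒪 C) → Model U
  U-reduct M = record
    { alg       = reduct (S ⊎ˢ signature) inj₁ M.alg
    ; complete  = M.complete
    ; satisfies = Equivalence.to (Image⇔reduct (S ⊎ˢ signature) inj₁ M.alg U) λ φ m → M.satisfies φ (axiom (inj₁ m))
    }
    where module M = Model M

  -- Different summands are at distance infinity, so non-expansiveness only has to be checked within
  -- one summand, where it is contractivity of a single operation. `glue` goes in the opposite
  -- direction.
  operators : (M : Model (U ⊕ 𝒪 C)) → NonExpansive (Sum (Op signature) (summand C (Model.met M))) (Model.met M)
  operators M = ne (λ (f , x) → fun (M.ops (inj₂ f)) x)
    λ { _ _ r (same {f} {x} {y} p) → ⊨𝒪⇒contractive (reduct (S ⊎ˢ signature) inj₂ M.alg) M⊨𝒪 f x y r p }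
    where
    module M = Model M
    M⊨𝒪 : reduct (S ⊎ˢ signature) inj₂ M.alg ⊨ 𝒪 C
    M⊨𝒪 = Equivalence.to (Image⇔reduct (S ⊎ˢ signature) inj₂ M.alg (𝒪 C)) λ φ m → M.satisfies φ (axiom (inj₂ m))

  reductHom : ∀ {A B : QAlg (S ⊎ˢ signature)} → Hom A B →
                Hom (reduct (S ⊎ˢ signature) inj₁ A) (reduct (S ⊎ˢ signature) inj₁ B)
  reductHom h = record { hom = Hom.hom h ; preserves = λ f → Hom.preserves h (inj₁ f) }

  module _ (N : Model U) (g : NonExpansive (Sum (Op signature) (summand C (Model.met N))) (Model.met N)) where
    private module N = Model N

    glueAlg : QAlg (S ⊎ˢ signature)
    glueAlg = record
      { met = N.met
      ; ops = λ where
          (inj₁ f) → N.ops f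
          (inj₂ f) → ne (λ x → fun g (f , x)) λ x y r p → nonexp g (f , x) (f , y) r (same (summand-⊑ N.met f p))
      }

    glueAlg-U : Image (S ⊎ˢ signature) inj₁ U ⊆ Satisfies glueAlg
    glueAlg-U = Equivalence.from (Image⇔reduct (S ⊎ˢ signature) inj₁ glueAlg U) N.satisfies

    glueAlg-𝒪 : Image (S ⊎ˢ signature) inj₂ (𝒪 C) ⊆ Satisfies glueAlg
    glueAlg-𝒪 = Equivalence.from (Image⇔reduct (S ⊎ˢ signature) inj₂ glueAlg (𝒪 C))
      (contractive⇒⊨𝒪 (reduct (S ⊎ˢ signature) inj₂ glueAlg) λ f x y r p → nonexp g (f , x) (f , y) r (same p))

    glueAlg-axioms : SumAxioms U (𝒪 C) ⊆ Satisfies glueAlg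
    glueAlg-axioms φ (inj₁ m) = glueAlg-U φ m
    glueAlg-axioms φ (inj₂ m) = glueAlg-𝒪 φ m

    -- What an algebra satisfies is itself a theory, so the generating equations suffice, and each
    -- of the two families is checked on its own reduct.
    glueAlg⊨⊕ : glueAlg ⊨ U ⊕ 𝒪 C
    glueAlg⊨⊕ = ⊨-axioms (generated-axiomatizes (SumAxioms U (𝒪 C))) glueAlg glueAlg-axioms

    glue : Model (U ⊕ 𝒪 C)
    glue = record { alg = glueAlg ; complete = N.complete ; satisfies = glueAlg⊨⊕ }

  private
    module Free⊕ = LeftAdjoint (forget-leftAdjoint (U ⊕ 𝒪 C) (⊕-closed U (𝒪 C) U-closed (𝒪-closed C)))
    module ℂT⊕ = Monad
      (inducedMonad (forget-leftAdjoint (U ⊕ 𝒪 C) (⊕-closed U (𝒪 C) U-closed (𝒪-closed C))))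

  open FreeBialgebras (forget-leftAdjoint U U-closed) ⊎-coproducts (Σ̃ C)
  open Bialgebras ⊎-coproducts (inducedMonad (forget-leftAdjoint U U-closed)) (Σ̃ C)
  open Resumption ⊎-coproducts (inducedMonad (forget-leftAdjoint U U-closed)) (Σ̃ C)

  -- The η-expansions of act and b make Agda compare carriers and balls only, instead of whole metric spaces.
  freeBialgebra : ∀ X → FreeBialgebra X
  freeBialgebra X = record
    { A           = U-reduct (Free⊕.Free X)
    ; act         = ne (fun (operators (Free⊕.Free X))) (nonexp (operators (Free⊕.Free X)))
    ; gen         = Free⊕.unit X
    ; ext         = λ {B} b y → reductHom (Free⊕.extend {X} {glue B (ne (fun b) (nonexp b))} y)
    ; ext-act     = λ {B} b y (f , x) → Hom.preserves (Free⊕.extend {X} {glue B (ne (fun b) (nonexp b))} y) (inj₂ f) x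
    ; ext-gen     = λ {B} b y → Free⊕.extend-∘ {X} {glue B (ne (fun b) (nonexp b))} y
    -- A `U`-homomorphism that commutes with the `Σ̃`-actions preserves the symbols of both types,
    -- so uniqueness for the sum theory applies.
    ; ext-unique  = λ {B} {b} {y} h p q → Free⊕.extend-uniq {X} {glue B (ne (fun b) (nonexp b))} {y}
        (record { hom = Hom.hom h ; preserves = λ { (inj₁ f) → Hom.preserves h f ; (inj₂ f) x → p (f , x) } }) q
    }

  freeBialgebraMonad : FreeBialgebraMonad
    (inducedMonad (forget-leftAdjoint (U ⊕ 𝒪 C) (⊕-closed U (𝒪 C) U-closed (𝒪-closed C))))
  freeBialgebraMonad = record
    { freeBialgebra = freeBialgebra
    ; enter         = λ X → ne (λ x → x) (λ _ _ _ p → p)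
    ; leave         = λ X → ne (λ x → x) (λ _ _ _ p → p)
    ; enter∘leave   = λ X x → Met.≈-refl (Model.met (Free⊕.Free X)) {x}
    ; leave∘enter   = λ X x → Met.≈-refl (Model.met (Free⊕.Free X)) {x}
    ; enter-η       = λ X x → Met.≈-refl (Model.met (Free⊕.Free X)) {fun (Free⊕.unit X) x}
    ; map           = λ {X} {Y} f → reductHom (Free⊕.extend {X} {Free⊕.Free Y} (Free⊕.unit Y ∘NE f))
    ; map-act       = λ {X} {Y} f (o , x) → Hom.preserves (Free⊕.extend {X} {Free⊕.Free Y} (Free⊕.unit Y ∘NE f)) (inj₂ o) x
    ; enter-T₁      = λ {X} {Y} f x → Met.≈-refl (Model.met (Free⊕.Free Y)) {fun (ℂT⊕.T₁ {X} {Y} f) x}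
    ; join          = λ X → reductHom (Free⊕.extend {ℂT⊕.T₀ X} {Free⊕.Free X} idNE)
    ; join-act      = λ X (o , x) → Hom.preserves (Free⊕.extend {ℂT⊕.T₀ X} {Free⊕.Free X} idNE) (inj₂ o) x
    ; enter-μ       = λ X x → Met.≈-refl (Model.met (Free⊕.Free X)) {fun (ℂT⊕.μ X) x}
    }

  initial : ∀ X → InitialAlgebra (Step X)
  initial X = FreeBialgebra.initialAlgebra {X} (freeBialgebra X)

  isFreeResumption : IsFreeResumption ⊎-coproducts (Σ̃ C) (ℂT U U-closed)
                       (ℂT (U ⊕ 𝒪 C) (⊕-closed U (𝒪 C) U-closed (𝒪-closed C)))
  -- Transport along refl, so that the two sides of the definition of ℂT are compared once and not inside every type.
  isFreeResumption = subst₂ (IsFreeResumption ⊎-coproducts (Σ̃ C))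
    {inducedMonad (forget-leftAdjoint U U-closed)} {ℂT U U-closed}
    {inducedMonad (forget-leftAdjoint (U ⊕ 𝒪 C) (⊕-closed U (𝒪 C) U-closed (𝒪-closed C)))}
    {ℂT (U ⊕ 𝒪 C) (⊕-closed U (𝒪 C) U-closed (𝒪-closed C))}
    refl refl (initial , λ I → canonicalMonad I , resumption-iso freeBialgebraMonad I)

corollary5p12 : (C : ContractiveSignature) (S : Signature) (U : Theory S) (U-continuous : Continuous U) →
    let U-closed = continuous⇒closed U-continuous
        open Resumption ⊎-coproducts (ℂT U U-closed) (Σ̃ C)
    in ((X : CMet) → InitialAlgebra (Step X)) ×
       ((I : (X : CMet) → InitialAlgebra (Step X)) →
         Σ[ R ∈ CanonicalMonad I ]
           MonadIso (CanonicalMonad.monad R) (ℂT (U ⊕ 𝒪 C) (⊕-closed U (𝒪 C) U-closed (𝒪-closed C))))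
corollary5p12 C S U U-continuous = SumModels.isFreeResumption C U (continuous⇒closed U-continuous)
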